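{- For MLAPD on any rooted tree of depth $D$, the online algorithm \textsc{Waterfall} is $D$-competitive: on every instance, the total cost of its schedule is at most $D$ times the cost of an optimal schedule.
   Context: MLAPD: an instance is a rooted tree $\mathcal{T}$ with root $r$ and positive node costs $c(v)>0$, together with a set of requests $\rho=(v,a,d)$ issued at node $v$ with arrival time $a$ and deadline $d\ge a$ (deadlines distinct). A service $(S,t)$ is a subtree $S\ni r$ of $\mathcal{T}$ transmitted at time $t$, costing $c(S)=\sum_{u\in S}c(u)$; it satisfies $(v,a,d)$ if $v\in S$ and $a\le t\le d$. A feasible schedule satisfies every request; its cost is the sum of its service costs. Online: requests are revealed at arrival; the tree is known. Depth $D$: maximum number of nodes on a root-to-leaf path. $c$-competitive: cost at most $c$ times optimal on every instance. $\mathcal{T}_v$ is the subtree rooted at $v$. A request is pending at time $t$ if it has arrived by $t$ and was not satisfied by earlier transmissions. For a pending request $\rho$ in $\mathcal{T}_v$, $P(v\to\rho)$ is the node set of the path from $v$ to the node of $\rho$, $P_\rho=P(r\to\rho)$, and for a node set $S$, $P(v\to\rho\mid S)=P(v\to\rho)\setminus S$. \textsc{Waterfall}: every node $u$ carries a price $p(u)$, initialized to $c(u)$; write $p(X)=\sum_{u\in X}p(u)$. When a pending request $\rho$ reaches its deadline $t=d_\rho$: set $S=P_\rho$ and $p(v)=c(v)$ for $v\in P_\rho$; put the nodes of $P_\rho$ into a FIFO queue $Q$; while $Q\ne\emptyset$, dequeue a node $v$, run the $v$-fall on $S$ and enqueue every node it returns; finally transmit $(S,t)$. The $v$-fall: set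 $A=\emptyset$ and budget $b=c(v)$; go through the pending requests $\gamma$ in $\mathcal{T}_v$ in increasing order of deadline; for each, let $P=P(v\to\gamma\mid S)$ with the current $S$; if $p(P)>b$, replace $p(u)$ by $p(u)(1-b/p(P))$ for every $u\in P$ and stop; otherwise add $P$ to $A$ and to $S$, set $b\gets b-p(P)$, and reset $p(u)=c(u)$ for all $u\in P$. The $v$-fall returns $A$. -}

module Defs where

open import Algebra.Bundles using (CommutativeRing)
import Algebra.Definitions.RawMonoid as RawMonoidDefinitions
import Algebra.Properties.CommutativeMonoid.Sum as CommutativeMonoidSum
open import Algebra.Structures using (IsCommutativeRing)
open import Data.Bool.Base using (true; false; if_then_else_)
open import Data.Fin.Base using (Fin; zero; suc)
open import Data.Fin.Properties using (all?; _≟_)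
open import Data.Fin.Subset using (Subset; ∣_∣; _∈_; _∪_; _─_; ∁; ⊥)
open import Data.Fin.Subset.Properties using (_∈?_; ∣⊥∣≡0)
open import Data.List.Base using (List; []; _∷_; _++_; map; foldr; foldl; filter; length; allFin)
open import Data.List.Extrema.Nat using (max)
open import Data.List.Properties using (length-map; length-++)
open import Data.List.Relation.Binary.Permutation.Propositional using (_↭_)
open import Data.List.Relation.Binary.Permutation.Propositional.Properties using (↭-length)
open import Data.List.Relation.Unary.All using (All)
open import Data.List.Relation.Unary.Any using (Any; any?)
open import Data.List.Relation.Unary.Unique.Propositional using (Unique)
import Data.List.Sort as Sort
open import Data.Nat.Base as ℕ using (ℕ; zero; suc; z≤n; s≤s)
open import Data.Nat.GeneralisedArithmetic using (iterate)
import Data.Nat.Properties as ℕ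
open import Data.Product.Base using (∃; _×_; _,_; proj₁; proj₂)
open import Data.Vec.Base using ([]; _∷_; lookup; tabulate)
open import Level using (Level; _⊔_) renaming (suc to lsuc)
open import Relation.Binary.Bundles using (DecTotalOrder)
import Relation.Binary.Construct.NonStrictToStrict as NonStrictToStrict
import Relation.Binary.Construct.On as On
open import Relation.Binary.Core using (Rel)
open import Relation.Binary.Definitions using (Decidable)
open import Relation.Binary.PropositionalEquality using (_≡_; _≢_; refl; sym; trans; cong; subst)
open import Relation.Binary.Structures using (IsDecTotalOrder)
open import Relation.Nullary using (¬_; Dec; yes; no; does)
open import Relation.Nullary.Decidable using (¬?; _×-dec_; _→-dec_)

-- Costs, prices and times are taken in an arbitrary linearly ordered field; ℝ
-- (classically) and ℚ are instances.  The value of 0# ⁻¹ is unconstrained.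
record OrderedField (a ℓ : Level) : Set (lsuc (a ⊔ ℓ)) where
  infix  8 _⁻¹
  infix  8 -_
  infixl 7 _*_
  infixl 6 _+_ _-_
  infix  4 _≤_
  field
    Carrier : Set a
    _+_ _*_ : Carrier → Carrier → Carrier
    -_ _⁻¹  : Carrier → Carrier
    0# 1#   : Carrier
    _≤_     : Rel Carrier ℓ
    isCommutativeRing : IsCommutativeRing _≡_ _+_ _*_ -_ 0# 1#
    isDecTotalOrder   : IsDecTotalOrder _≡_ _≤_
    0≢1         : 0# ≢ 1#
    *-inverseʳ  : ∀ x → x ≢ 0# → x * x ⁻¹ ≡ 1#
    +-monoˡ-≤   : ∀ z {x y} → x ≤ y → x + z ≤ y + z
    *-nonneg    : ∀ {x y} → 0# ≤ x → 0# ≤ y → 0# ≤ x * y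

  commutativeRing : CommutativeRing a a
  commutativeRing = record { isCommutativeRing = isCommutativeRing }

  decTotalOrder : DecTotalOrder a a ℓ
  decTotalOrder = record { isDecTotalOrder = isDecTotalOrder }

  open IsDecTotalOrder isDecTotalOrder public using (_≤?_)
  open NonStrictToStrict _≡_ _≤_ public using (_<_)

  _-_ : Carrier → Carrier → Carrier
  x - y = x + (- y)

  private module R = CommutativeRing commutativeRing

  open CommutativeMonoidSum R.+-commutativeMonoid public using (sum)
  open RawMonoidDefinitions R.+-rawMonoid using () renaming (_×_ to _×ᶠ_)

  fromℕ : ℕ → Carrier
  fromℕ n = n ×ᶠ 1#

-- A finite rooted tree as a parent map; the root is its own parent.
record RootedTree : Set where
  field
    size        : ℕ
    root        : Fin size
    parent      : Fin size → Fin size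
    parent-root : parent root ≡ root
    rooted      : ∀ v → ∃ λ k → iterate parent v k ≡ root

  Node : Set
  Node = Fin size

  infix 4 _≼_ _≼?_

  -- u is v or an ancestor of v, i.e. v is a node of the subtree rooted at u.
  _≼_ : Rel Node _
  u ≼ v = ∃ λ k → iterate parent v k ≡ u

  _≼?_ : Decidable _≼_
  u ≼? v = search (proj₁ (rooted v)) v (proj₂ (rooted v))
    where
    iterate-root : ∀ k → iterate parent root k ≡ root
    iterate-root zero    = refl
    iterate-root (suc k) = trans (cong (λ w → iterate parent w k) parent-root) (iterate-root k)

    search : ∀ k w → iterate parent w k ≡ root → Dec (u ≼ w)
    search k w eq with w ≟ u
    search k       w eq | yes w≡u = yes (0 , w≡u)
    search zero    w eq | no  w≢u = no λ (k , e) →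
      w≢u (trans eq (trans (sym (iterate-root k)) (subst (λ x → iterate parent x k ≡ u) eq e)))
    search (suc k) w eq | no  w≢u with search k (parent w) eq
    ... | yes (j , e) = yes (suc j , e)
    ... | no  u⋠      = no λ { (zero , e) → w≢u e ; (suc j , e) → u⋠ (j , e) }

  path : Node → Node → Subset size
  path v w = tabulate λ u → does ((v ≼? u) ×-dec (u ≼? w))

  -- The only node allowed to have a leaf as its parent is the root, for a root
  -- that is itself a leaf.
  Leaf : Node → Set
  Leaf v = ∀ u → parent u ≡ v → u ≡ root

  leaf? : ∀ v → Dec (Leaf v)
  leaf? v = all? λ u → (parent u ≟ v) →-dec (u ≟ root)

  depth : ℕ
  depth = max 0 (map (λ v → ∣ path root v ∣) (filter leaf? (allFin size)))

  -- A subtree containing the root is a node set closed under taking parents.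
  IsRootedSubtree : Subset size → Set
  IsRootedSubtree S = root ∈ S × (∀ v → v ∈ S → parent v ∈ S)

elements : ∀ {n} → Subset n → List (Fin n)
elements []          = []
elements (true  ∷ X) = zero ∷ map suc (elements X)
elements (false ∷ X) = map suc (elements X)

module MLAPD {a ℓ} (F : OrderedField a ℓ) where
  open OrderedField F

  record WeightedTree : Set (a ⊔ ℓ) where
    field
      tree : RootedTree
    open RootedTree tree public
    field
      cost          : Node → Carrier
      cost-positive : ∀ v → 0# < cost v

  module OnTree (T : WeightedTree) where
    open WeightedTree T

    record Request : Set (a ⊔ ℓ) where
      field
        node     : Node
        arrival  : Carrier
        deadline : Carrier
        arrival≤deadline : arrival ≤ deadline
    open Request public

    record RequestSet : Set (a ⊔ ℓ) where
      field
        requests : List Request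
        distinct-deadlines : Unique (map deadline requests)
    open RequestSet public

    record Service : Set a where
      constructor _at_
      field
        nodes : Subset size
        time  : Carrier
    open Service public

    Schedule : Set a
    Schedule = List Service

    total : (Node → Carrier) → Subset size → Carrier
    total f X = sum λ u → if lookup X u then f u else 0#

    scheduleCost : Schedule → Carrier
    scheduleCost σ = foldr _+_ 0# (map (λ s → total cost (nodes s)) σ)

    Satisfies : Request → Service → Set ℓ
    Satisfies ρ s = node ρ ∈ nodes s × arrival ρ ≤ time s × time s ≤ deadline ρ

    satisfies? : Decidable Satisfies
    satisfies? ρ s = (node ρ ∈? nodes s) ×-dec (arrival ρ ≤? time s) ×-dec (time s ≤? deadline ρ)

    Feasible : RequestSet → Schedule → Set (a ⊔ ℓ)
    Feasible R σ = All (λ s → IsRootedSubtree (nodes s)) σ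
                 × All (λ ρ → Any (Satisfies ρ) σ) (requests R)

    Optimal : RequestSet → Schedule → Set (a ⊔ ℓ)
    Optimal R σ = Feasible R σ × (∀ τ → Feasible R τ → scheduleCost σ ≤ scheduleCost τ)

    Competitive : Carrier → (RequestSet → Schedule) → Set (a ⊔ ℓ)
    Competitive κ alg = ∀ R → Feasible R (alg R)
      × (∀ opt → Optimal R opt → scheduleCost (alg R) ≤ κ * scheduleCost opt)

    Prices : Set a
    Prices = Node → Carrier

    reset : Subset size → Prices → Prices
    reset X p u = if lookup X u then cost u else p u

    discount : Subset size → Carrier → Prices → Prices
    discount X q p u = if lookup X u then p u * q else p u

    record FallResult : Set a where
      constructor result
      field
        returned  : Subset size
        service   : Subset size
        newPrices : Prices
    open FallResult public

    -- The arguments are the requests still to be examined, b, A, S and p.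
    fallLoop : Node → List Request → Carrier → Subset size → Subset size → Prices → FallResult
    fallLoop v []       b A S p = result A S p
    fallLoop v (γ ∷ γs) b A S p =
      let P = path v (node γ) ─ S in
      if does (total p P ≤? b)
        then fallLoop v γs (b - total p P) (A ∪ P) (S ∪ P) (reset P p)
        else result A S (discount P (1# - b * total p P ⁻¹) p)

    -- `pending` lists the pending requests in increasing order of deadline.
    fall : (pending : List Request) → Node → Subset size → Prices → FallResult
    fall pending v S p = fallLoop v (filter (λ γ → v ≼? node γ) pending) (cost v) ⊥ S p

    -- The order in which the nodes of a set X enter the queue is not prescribed
    -- by the algorithm.  It may depend on the transmission time and on the
    -- current S, which together identify each enqueuing of a nonempty set within
    -- a run; so every possible run arises from some EnqueueOrder.
    record EnqueueOrder : Set a where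
      field
        arrange   : Carrier → Subset size → Subset size → List Node
        arrange-↭ : ∀ t S X → arrange t S X ↭ elements X

    module Waterfall (order : EnqueueOrder) where
      open EnqueueOrder order

      -- `fuel` bounds the number of dequeue operations; drain-exhausts below
      -- shows that the bound used in `serve` always empties the queue.
      drain : (fuel : ℕ) → Carrier → List Request → List Node → Subset size → Prices
            → List Node × Subset size × Prices
      drain fuel       t pending []      S p = [] , S , p
      drain zero       t pending (v ∷ Q) S p = v ∷ Q , S , p
      drain (suc fuel) t pending (v ∷ Q) S p =
        let r = fall pending v S p in
        drain fuel t pending (Q ++ arrange t (service r) (returned r)) (service r) (newPrices r)

      serve : List Request → Request → Prices → Service × Prices
      serve pending ρ p =
        let t   = deadline ρ
            S₀  = path root (node ρ)
            Q₀  = arrange t S₀ S₀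
            out = drain (length Q₀ ℕ.+ ∣ ∁ S₀ ∣) t pending Q₀ S₀ (reset S₀ p)
        in (proj₁ (proj₂ out) at t) , proj₂ (proj₂ out)

      Pending : Schedule → Carrier → Request → Set (a ⊔ ℓ)
      Pending σ t ρ = arrival ρ ≤ t × ¬ Any (Satisfies ρ) σ

      pending? : ∀ σ t ρ → Dec (Pending σ t ρ)
      pending? σ t ρ = (arrival ρ ≤? t) ×-dec ¬? (any? (satisfies? ρ) σ)

      open Sort (On.decTotalOrder decTotalOrder deadline) public using (sort; sort-↭; sort-↗)

      -- Waterfall acts only at deadlines, so time is simulated by visiting the
      -- requests in increasing order of deadline.
      onDeadline : List Request → Prices × Schedule → Request → Prices × Schedule
      onDeadline ρs (p , σ) ρ =
        if does (pending? σ (deadline ρ) ρ)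
          then (let s , p′ = serve (filter (pending? σ (deadline ρ)) ρs) ρ p in p′ , s ∷ σ)
          else (p , σ)

      waterfall : RequestSet → Schedule
      waterfall R = let ρs = sort (requests R) in proj₂ (foldl (onDeadline ρs) (cost , []) ρs)

      private
        ∪─-bound : ∀ {n} (A S X : Subset n) →
          ∣ A ∪ (X ─ S) ∣ ℕ.+ ∣ ∁ (S ∪ (X ─ S)) ∣ ℕ.≤ ∣ A ∣ ℕ.+ ∣ ∁ S ∣
        ∪─-bound []      []      []      = z≤n
        ∪─-bound (true  ∷ A) (true  ∷ S) (_     ∷ X) = s≤s (∪─-bound A S X)
        ∪─-bound (false ∷ A) (true  ∷ S) (_     ∷ X) = ∪─-bound A S X
        ∪─-bound (true  ∷ A) (false ∷ S) (true  ∷ X) =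
          s≤s (ℕ.≤-trans (∪─-bound A S X) (ℕ.+-monoʳ-≤ ∣ A ∣ (ℕ.n≤1+n _)))
        ∪─-bound (false ∷ A) (false ∷ S) (true  ∷ X) =
          ℕ.≤-trans (s≤s (∪─-bound A S X)) (ℕ.≤-reflexive (sym (ℕ.+-suc ∣ A ∣ _)))
        ∪─-bound (true  ∷ A) (false ∷ S) (false ∷ X) =
          s≤s (ℕ.≤-trans (ℕ.≤-reflexive (ℕ.+-suc ∣ A ∪ (X ─ S) ∣ _))
            (ℕ.≤-trans (s≤s (∪─-bound A S X)) (ℕ.≤-reflexive (sym (ℕ.+-suc ∣ A ∣ _)))))
        ∪─-bound (false ∷ A) (false ∷ S) (false ∷ X) =
          ℕ.≤-trans (ℕ.≤-reflexive (ℕ.+-suc ∣ A ∪ (X ─ S) ∣ _))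
            (ℕ.≤-trans (s≤s (∪─-bound A S X)) (ℕ.≤-reflexive (sym (ℕ.+-suc ∣ A ∣ _))))

        length-elements : ∀ {n} (X : Subset n) → length (elements X) ≡ ∣ X ∣
        length-elements []          = refl
        length-elements (true  ∷ X) = cong suc (trans (length-map suc (elements X)) (length-elements X))
        length-elements (false ∷ X) = trans (length-map suc (elements X)) (length-elements X)

        fallLoop-bound : ∀ v γs b A S p → let r = fallLoop v γs b A S p in
          ∣ returned r ∣ ℕ.+ ∣ ∁ (service r) ∣ ℕ.≤ ∣ A ∣ ℕ.+ ∣ ∁ S ∣
        fallLoop-bound v []       b A S p = ℕ.≤-refl
        fallLoop-bound v (γ ∷ γs) b A S p with does (total p (path v (node γ) ─ S) ≤? b)
        ... | true  = ℕ.≤-trans (fallLoop-bound v γs _ _ _ _) (∪─-bound A S (path v (node γ)))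
        ... | false = ℕ.≤-refl

        fall-bound : ∀ pending v S p → let r = fall pending v S p in
          ∣ returned r ∣ ℕ.+ ∣ ∁ (service r) ∣ ℕ.≤ ∣ ∁ S ∣
        fall-bound pending v S p = ℕ.≤-trans
          (fallLoop-bound v (filter (λ γ → v ≼? node γ) pending) (cost v) ⊥ S p)
          (ℕ.≤-reflexive (cong (ℕ._+ ∣ ∁ S ∣) (∣⊥∣≡0 size)))

      drain-exhausts : ∀ fuel t pending Q S p → length Q ℕ.+ ∣ ∁ S ∣ ℕ.≤ fuel →
        proj₁ (drain fuel t pending Q S p) ≡ []
      drain-exhausts zero       t pending []      S p _       = refl
      drain-exhausts (suc fuel) t pending []      S p _       = refl
      drain-exhausts (suc fuel) t pending (v ∷ Q) S p (s≤s h) =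
        drain-exhausts fuel t pending (Q ++ A′) S′ (newPrices r) (begin
          length (Q ++ A′) ℕ.+ ∣ ∁ S′ ∣             ≡⟨ cong (ℕ._+ ∣ ∁ S′ ∣) (length-++ Q) ⟩
          length Q ℕ.+ length A′ ℕ.+ ∣ ∁ S′ ∣       ≡⟨ cong (λ k → length Q ℕ.+ k ℕ.+ ∣ ∁ S′ ∣) ∣A′∣ ⟩
          length Q ℕ.+ ∣ returned r ∣ ℕ.+ ∣ ∁ S′ ∣  ≡⟨ ℕ.+-assoc (length Q) _ _ ⟩
          length Q ℕ.+ (∣ returned r ∣ ℕ.+ ∣ ∁ S′ ∣) ≤⟨ ℕ.+-monoʳ-≤ (length Q) (fall-bound pending v S p) ⟩
          length Q ℕ.+ ∣ ∁ S ∣                      ≤⟨ h ⟩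
          fuel                                      ∎)
        where
        open ℕ.≤-Reasoning
        r  = fall pending v S p
        S′ = service r
        A′ = arrange t S′ (returned r)
        ∣A′∣ : length A′ ≡ ∣ returned r ∣
        ∣A′∣ = trans (↭-length (arrange-↭ t S′ (returned r))) (length-elements (returned r))

{-# OPTIONS --safe #-}

-- Fix a feasible schedule opt.  At time t a node u is overdue if some pending
-- request in its subtree has a deadline before opt's next service of u after t.
-- Call a node served by Waterfall timely if it is not overdue, stuck if it is
-- still overdue after the service, and settled otherwise.
--
--  * Between two services at which u is settled, opt serves u; hence the settled
--    nodes together cost at most as much as opt.
--  * A stuck node spends its whole budget, and only on overdue nodes.  An overdue
--    node stays overdue until it is served.
--  * A timely node is paid in full by the falls of proper ancestors, none of
--    which is stuck.
--
-- A fall pays only for proper descendants, so the timely nodes of levels ≤ k + 1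
-- cost at most as much as the timely and settled nodes of levels ≤ k: the timely
-- cost on level k + 1 is at most the settled cost above that level.  Dually, the
-- stuck cost on level k + 1 is at most the settled cost below it.  So Waterfall
-- spends at most the cost of opt on every level.
module Submission where

open import Defs
open import Algebra.Bundles using (CommutativeRing)
import Algebra.Properties.CommutativeMonoid.Sum as CommutativeMonoidSum
import Algebra.Properties.Ring as RingProperties
import Algebra.Properties.Semiring.Sum as SemiringSum
import Algebra.Solver.Ring.NaturalCoefficients.Default as SemiringSolver
open import Data.Bool.Base using (Bool; true; false; if_then_else_; not; _∧_; _∨_)
open import Data.Bool.Properties using (∧-identityʳ; ∧-zeroʳ)
open import Data.Fin.Base using (Fin; zero; suc)
import Data.Fin.Properties as Fin
open import Data.Fin.Subset using (Subset; ∣_∣; _∈_; _∉_; _⊆_; _∪_; _─_; ∁; ⊥)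
open import Data.Fin.Subset.Properties using (_∈?_; ∣p∣≤n; p⊂q⇒∣p∣<∣q∣; x∈p⇒∣p-x∣<∣p∣)
open import Data.List.Base using (List; []; _∷_; _++_; map; foldr; foldl; filter; length; allFin)
open import Data.List.Extrema.Nat using (xs≤max)
import Data.List.Membership.Propositional as List
import Data.List.Membership.Propositional.Properties as List
open import Data.List.Relation.Binary.Permutation.Propositional as Perm using (_↭_)
import Data.List.Relation.Binary.Permutation.Propositional.Properties as Perm
open import Data.List.Relation.Unary.All as All using (All; []; _∷_)
import Data.List.Relation.Unary.All.Properties as All
open import Data.List.Relation.Unary.AllPairs as AllPairs using (AllPairs; []; _∷_)
import Data.List.Relation.Unary.AllPairs.Properties as AllPairs
open import Data.List.Relation.Unary.Any as Any using (Any; here; there; any?)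
import Data.List.Relation.Unary.Sorted.TotalOrder.Properties as Sorted
open import Data.Nat.Base as ℕ using (ℕ; zero; suc)
open import Data.Nat.GeneralisedArithmetic using (iterate)
import Data.Nat.Properties as ℕ
open import Data.Product.Base using (∃; _×_; _,_; proj₁; proj₂)
open import Data.Sum.Base using (_⊎_; inj₁; inj₂)
open import Data.Unit.Base using (⊤; tt)
open import Data.Vec.Base using ([]; _∷_; lookup; here; there)
open import Data.Vec.Properties using (lookup∘tabulate; lookup-zipWith; lookup-replicate; []=⇒lookup; lookup⇒[]=)
open import Function.Base using (_∘_)
import Level
open import Relation.Binary.Bundles using (DecTotalOrder)
import Relation.Binary.Construct.On as On
open import Relation.Binary.PropositionalEquality using (_≡_; _≢_; refl; sym; trans; cong; cong₂; subst; subst₂; module ≡-Reasoning)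
open import Relation.Nullary using (¬_; Dec; yes; no; does; contradiction)
open import Relation.Nullary.Decidable using (_×-dec_; _→-dec_; dec-true; dec-false; ¬?; decidable-stable)

-- A fall may pay for nodes many levels further down, and a discount given in one service may become
-- a purchase only in a much later one. Hence costs can be matched neither level by level nor
-- service by service. The first obstacle is met by balancing the levels up to `k` against the
-- levels up to `k + 1`: money only moves downwards, so only the cut matters. The second is met by a
-- potential, `outlay`, in which purchases and discounts both count for exactly the budget that they
-- use. Between services the outstanding discounts are divided by whether the last service left
-- their node overdue. On other nodes they are advance payments for timely services; on overdue
-- nodes they are what stuck nodes have already spent. A node leaves the overdue class only by being
-- served, which resets its price. A node that enters the class as time passes takes its discount
-- along, which weakens neither bound.

trueOrFalse : ∀ w → w ≡ true ⊎ w ≡ false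
trueOrFalse true  = inj₁ refl
trueOrFalse false = inj₂ refl

does-true⁻ : ∀ {p} {P : Set p} (P? : Dec P) → does P? ≡ true → P
does-true⁻ (yes h) _ = h

if-does : ∀ {p a r} {P : Set p} {A : Set a} (I : A → Set r) {x y} (P? : Dec P) →
  (P → I x) → (¬ P → I y) → I (if does P? then x else y)
if-does I (yes h) yes′ no′ = yes′ h
if-does I (no ¬h) yes′ no′ = no′ ¬h

∈⇒lookup : ∀ {n} {X : Subset n} {u} → u ∈ X → lookup X u ≡ true
∈⇒lookup = []=⇒lookup

lookup⇒∈ : ∀ {n} {X : Subset n} {u} → lookup X u ≡ true → u ∈ X
lookup⇒∈ {X = X} {u} = lookup⇒[]= u X

lookup⇒∉ : ∀ {n} {X : Subset n} {u} → lookup X u ≡ false → u ∉ X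
lookup⇒∉ eq u∈X with () ← trans (sym eq) (∈⇒lookup u∈X)

lookup-─ : ∀ {n} (X S : Subset n) u → lookup (X ─ S) u ≡ lookup X u ∧ not (lookup S u)
lookup-─ (x ∷ X) (false ∷ S) zero    = sym (∧-identityʳ x)
lookup-─ (x ∷ X) (true  ∷ S) zero    = sym (∧-zeroʳ x)
lookup-─ (_ ∷ X) (false ∷ S) (suc u) = lookup-─ X S u
lookup-─ (_ ∷ X) (true  ∷ S) (suc u) = lookup-─ X S u

lookup-∪─ : ∀ {n} (Y X S : Subset n) u →
  lookup (Y ∪ (X ─ S)) u ≡ lookup Y u ∨ (lookup X u ∧ not (lookup S u))
lookup-∪─ Y X S u = trans (lookup-zipWith _∨_ u Y (X ─ S)) (cong (lookup Y u ∨_) (lookup-─ X S u))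

∪─-grows : ∀ {n} (X S : Subset n) {u} → u ∈ S → u ∈ S ∪ (X ─ S)
∪─-grows X S {u} u∈S = lookup⇒∈ (trans (lookup-∪─ S X S u) (cong (_∨ (lookup X u ∧ not (lookup S u))) (∈⇒lookup u∈S)))

∪─-covers : ∀ {n} (X S : Subset n) {u} → u ∈ X → u ∈ S ∪ (X ─ S)
∪─-covers X S {u} u∈X = lookup⇒∈ (trans (lookup-∪─ S X S u) bits)
  where
  bits : lookup S u ∨ (lookup X u ∧ not (lookup S u)) ≡ true
  bits rewrite ∈⇒lookup u∈X with lookup S u
  ... | true  = refl
  ... | false = refl

∪─⁻ : ∀ {n} (X S : Subset n) {u} → u ∈ S ∪ (X ─ S) → u ∈ S ⊎ u ∈ X
∪─⁻ X S {u} u∈ with lookup S u in s | lookup X u in x | trans (sym (lookup-∪─ S X S u)) (∈⇒lookup u∈)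
... | true  | _    | _  = inj₁ (lookup⇒∈ s)
... | false | true | _  = inj₂ (lookup⇒∈ x)

-- The bits tell whether a node lies in the service before a fall, in the returned set, and in the
-- service after the fall. The new service is thus the disjoint union of the other two, which is why
-- every node is queued exactly once.
data Split : Bool → Bool → Bool → Set where
  old     : Split true  false true
  new     : Split false true  true
  outside : Split false false false

split-⊥ : ∀ s → Split s false s
split-⊥ true  = old
split-⊥ false = outside

split-∪ : ∀ {s₀ a s} x → Split s₀ a s → Split s₀ (a ∨ (x ∧ not s)) (s ∨ (x ∧ not s))
split-∪ false old     = old
split-∪ true  old     = old
split-∪ false new     = new
split-∪ true  new     = new
split-∪ false outside = outside
split-∪ true  outside = new

-- Ordered field arithmetic and sums over sets of nodes.

module FieldProperties {a ℓ} (F : OrderedField a ℓ) where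
  open OrderedField F
  module R = CommutativeRing commutativeRing
  open DecTotalOrder decTotalOrder using ()
    renaming (total to ≤-total; refl to ≤-refl; reflexive to ≤-reflexive; trans to ≤-trans; antisym to ≤-antisym) public
  open RingProperties R.ring using (-‿involutive; -‿distribˡ-*; -‿distribʳ-*)
  open CommutativeMonoidSum R.+-commutativeMonoid using (sum-cong-≗; ∑-distrib-+; sum-replicate-zero) public
  open SemiringSum R.semiring using (*-distribʳ-sum) public
  open SemiringSolver R.commutativeSemiring public using (solve; _:=_; _:+_; _:*_; con)
  open ≡-Reasoning

  +-monoʳ-≤ : ∀ z {x y} → x ≤ y → z + x ≤ z + y
  +-monoʳ-≤ z {x} {y} x≤y = subst₂ _≤_ (R.+-comm x z) (R.+-comm y z) (+-monoˡ-≤ z x≤y)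

  +-mono-≤ : ∀ {w x y z} → w ≤ x → y ≤ z → w + y ≤ x + z
  +-mono-≤ {x = x} {y} w≤x y≤z = ≤-trans (+-monoˡ-≤ y w≤x) (+-monoʳ-≤ x y≤z)

  +-interchange : ∀ w x y z → (w + x) + (y + z) ≡ (w + y) + (x + z)
  +-interchange = solve 4 (λ w x y z → (w :+ x) :+ (y :+ z) := (w :+ y) :+ (x :+ z)) refl

  [x-y]+y≡x : ∀ x y → (x - y) + y ≡ x
  [x-y]+y≡x x y = begin
    (x + - y) + y  ≡⟨ R.+-assoc x (- y) y ⟩
    x + (- y + y)  ≡⟨ cong (x +_) (R.-‿inverseˡ y) ⟩
    x + 0#         ≡⟨ R.+-identityʳ x ⟩
    x              ∎

  [x+y]-y≡x : ∀ x y → (x + y) - y ≡ x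
  [x+y]-y≡x x y = begin
    (x + y) + - y  ≡⟨ R.+-assoc x y (- y) ⟩
    x + (y + - y)  ≡⟨ cong (x +_) (R.-‿inverseʳ y) ⟩
    x + 0#         ≡⟨ R.+-identityʳ x ⟩
    x              ∎

  +-cancelʳ-≤ : ∀ z {x y} → x + z ≤ y + z → x ≤ y
  +-cancelʳ-≤ z {x} {y} h = subst₂ _≤_ ([x+y]-y≡x x z) ([x+y]-y≡x y z) (+-monoˡ-≤ (- z) h)

  +-cancelʳ-≡ : ∀ z {x y} → x + z ≡ y + z → x ≡ y
  +-cancelʳ-≡ z {x} {y} h = trans (sym ([x+y]-y≡x x z)) (trans (cong (_- z) h) ([x+y]-y≡x y z))

  -- Turns a linear inequality into an identity of sums, without subtraction.
  ≤-shift : ∀ {w x y z} → w + y ≡ z + x → x ≤ y → w ≤ z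
  ≤-shift {y = y} {z} eq x≤y = +-cancelʳ-≤ y (≤-trans (≤-reflexive eq) (+-monoʳ-≤ z x≤y))

  x≤x+y : ∀ x {y} → 0# ≤ y → x ≤ x + y
  x≤x+y x 0≤y = ≤-trans (≤-reflexive (sym (R.+-identityʳ x))) (+-monoʳ-≤ x 0≤y)

  x≤y⇒0≤y-x : ∀ {x y} → x ≤ y → 0# ≤ y - x
  x≤y⇒0≤y-x {x} {y} x≤y = ≤-trans (≤-reflexive (sym (R.-‿inverseʳ x))) (+-monoˡ-≤ (- x) x≤y)

  x≤0⇒0≤-x : ∀ {x} → x ≤ 0# → 0# ≤ - x
  x≤0⇒0≤-x {x} x≤0 = ≤-trans (x≤y⇒0≤y-x x≤0) (≤-reflexive (R.+-identityˡ (- x)))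

  0≤1 : 0# ≤ 1#
  0≤1 with ≤-total 0# 1#
  ... | inj₁ h = h
  ... | inj₂ h = ≤-trans (*-nonneg (x≤0⇒0≤-x h) (x≤0⇒0≤-x h)) (≤-reflexive (begin
    - 1# * - 1#    ≡⟨ -‿distribˡ-* 1# (- 1#) ⟨
    - (1# * - 1#)  ≡⟨ cong -_ (R.*-identityˡ (- 1#)) ⟩
    - - 1#         ≡⟨ -‿involutive 1# ⟩
    1#             ∎))

  ⁻¹-nonneg : ∀ {x} → 0# ≤ x → x ≢ 0# → 0# ≤ x ⁻¹
  ⁻¹-nonneg {x} 0≤x x≢0 with ≤-total 0# (x ⁻¹)
  ... | inj₁ h = h
  ... | inj₂ h = contradiction (≤-antisym 0≤1 (≤-shift eq (*-nonneg 0≤x (x≤0⇒0≤-x h)))) 0≢1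
    where
    eq : 1# + x * - (x ⁻¹) ≡ 0# + 0#
    eq = begin
      1# + x * - (x ⁻¹)    ≡⟨ cong (1# +_) (sym (-‿distribʳ-* x (x ⁻¹))) ⟩
      1# + - (x * x ⁻¹)    ≡⟨ cong (λ y → 1# + - y) (*-inverseʳ x x≢0) ⟩
      1# + - 1#            ≡⟨ R.-‿inverseʳ 1# ⟩
      0#                   ≡⟨ R.+-identityˡ 0# ⟨
      0# + 0#              ∎

  *-monoʳ-≤ : ∀ {x y} z → 0# ≤ z → x ≤ y → x * z ≤ y * z
  *-monoʳ-≤ {x} {y} z 0≤z x≤y = ≤-shift eq (*-nonneg (x≤y⇒0≤y-x x≤y) 0≤z)
    where
    eq : x * z + (y - x) * z ≡ y * z + 0#
    eq = begin
      x * z + (y - x) * z  ≡⟨ solve 3 (λ x d z → x :* z :+ d :* z := (d :+ x) :* z) refl x (y - x) z ⟩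
      ((y - x) + x) * z    ≡⟨ cong (_* z) ([x-y]+y≡x y x) ⟩
      y * z                ≡⟨ R.+-identityʳ (y * z) ⟨
      y * z + 0#           ∎

  ratio≤1 : ∀ {x y} → x ≤ y → 0# ≤ y → y ≢ 0# → x * y ⁻¹ ≤ 1#
  ratio≤1 {x} {y} x≤y 0≤y y≢0 =
    ≤-trans (*-monoʳ-≤ (y ⁻¹) (⁻¹-nonneg 0≤y y≢0) x≤y) (≤-reflexive (*-inverseʳ y y≢0))

  x*[1-y]+x*y≡x : ∀ x y → x * (1# - y) + x * y ≡ x
  x*[1-y]+x*y≡x x y = begin
    x * (1# - y) + x * y  ≡⟨ R.distribˡ x (1# - y) y ⟨
    x * ((1# - y) + y)    ≡⟨ cong (x *_) ([x-y]+y≡x 1# y) ⟩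
    x * 1#                ≡⟨ R.*-identityʳ x ⟩
    x                     ∎

  sum-mono-≤ : ∀ {n} {f g : Fin n → Carrier} → (∀ i → f i ≤ g i) → sum f ≤ sum g
  sum-mono-≤ {zero}  h = ≤-refl
  sum-mono-≤ {suc n} h = +-mono-≤ (h zero) (sum-mono-≤ (h ∘ suc))

  sum-zero : ∀ {n} {f : Fin n → Carrier} → (∀ i → f i ≡ 0#) → sum f ≡ 0#
  sum-zero {n} h = trans (sum-cong-≗ h) (sum-replicate-zero n)

  infixr 8 _·_

  _·_ : Bool → Carrier → Carrier
  w · x = if w then x else 0#

  ·-nonneg : ∀ w {x} → 0# ≤ x → 0# ≤ w · x
  ·-nonneg true  0≤x = 0≤x
  ·-nonneg false 0≤x = ≤-refl

  ·-zero : ∀ w {x} → x ≡ 0# → w · x ≡ 0#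
  ·-zero true  x≡0 = x≡0
  ·-zero false x≡0 = refl

  ·-distrib-+ : ∀ w x y → w · (x + y) ≡ w · x + w · y
  ·-distrib-+ true  x y = refl
  ·-distrib-+ false x y = sym (R.+-identityˡ 0#)

  ·-*-assoc : ∀ w x y → w · (x * y) ≡ w · x * y
  ·-*-assoc true  x y = refl
  ·-*-assoc false x y = sym (R.zeroˡ y)

  -- Boolean weights allow sets given by a computed condition as well as subsets. For `W = lookup X`
  -- this is `total` by definition.
  sumOn : ∀ {n} → (Fin n → Bool) → (Fin n → Carrier) → Carrier
  sumOn W f = sum λ i → W i · f i

  sumOn-distrib-+ : ∀ {n} (W : Fin n → Bool) f g → sumOn W (λ i → f i + g i) ≡ sumOn W f + sumOn W g
  sumOn-distrib-+ W f g = trans (sum-cong-≗ λ i → ·-distrib-+ (W i) (f i) (g i))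
    (∑-distrib-+ (λ i → W i · f i) (λ i → W i · g i))

  sumOn-zero : ∀ {n} (W : Fin n → Bool) f → (∀ i → f i ≡ 0#) → sumOn W f ≡ 0#
  sumOn-zero W f f≡0 = sum-zero λ i → ·-zero (W i) (f≡0 i)

  sumOn-nonneg : ∀ {n} (W : Fin n → Bool) f → (∀ i → 0# ≤ f i) → 0# ≤ sumOn W f
  sumOn-nonneg W f 0≤f = subst (_≤ sumOn W f) (sumOn-zero W (λ _ → 0#) λ _ → refl)
    (sum-mono-≤ λ i → ≤-trans (≤-reflexive (·-zero (W i) refl)) (·-nonneg (W i) (0≤f i)))

  sumOn-complement : ∀ {n} (W : Fin n → Bool) f → sumOn W f + sumOn (not ∘ W) f ≡ sum f
  sumOn-complement W f = trans (sym (∑-distrib-+ (λ i → W i · f i) (λ i → not (W i) · f i))) (sum-cong-≗ pointwise)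
    where
    pointwise : ∀ i → W i · f i + not (W i) · f i ≡ f i
    pointwise i with W i
    ... | true  = R.+-identityʳ (f i)
    ... | false = R.+-identityˡ (f i)

  module _ {n} (W : Fin n → Bool) {f g : Fin n → Carrier} where

    sumOn-mono-≤ : (∀ i → W i ≡ true → f i ≤ g i) → sumOn W f ≤ sumOn W g
    sumOn-mono-≤ h = sum-mono-≤ pointwise
      where
      pointwise : ∀ i → W i · f i ≤ W i · g i
      pointwise i with W i in eq
      ... | true  = h i eq
      ... | false = ≤-refl

    sumOn-cong : (∀ i → W i ≡ true → f i ≡ g i) → sumOn W f ≡ sumOn W g
    sumOn-cong h = sum-cong-≗ pointwise
      where
      pointwise : ∀ i → W i · f i ≡ W i · g i
      pointwise i with W i in eq
      ... | true  = h i eq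
      ... | false = refl

    -- Nothing decreases outside `W`, so the increase inside `W` is at most the total increase. Both
    -- differences are written as sums to avoid subtraction.
    sumOn-gap-≤ : (∀ i → f i ≤ g i) → sumOn W g + sum f ≤ sumOn W f + sum g
    sumOn-gap-≤ h = subst₂ _≤_ (∑-distrib-+ (λ i → W i · g i) f) (∑-distrib-+ (λ i → W i · f i) g)
      (sum-mono-≤ pointwise)
      where
      pointwise : ∀ i → W i · g i + f i ≤ W i · f i + g i
      pointwise i with W i
      ... | true  = ≤-reflexive (R.+-comm (g i) (f i))
      ... | false = +-monoʳ-≤ 0# (h i)

    -- Nothing changes outside `W`, so the whole increase from `f` to `g` takes place inside.
    sumOn-gap-≡ : (∀ i → W i ≡ false → f i ≡ g i) → sumOn W g + sum f ≡ sumOn W f + sum g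
    sumOn-gap-≡ h = trans (sym (∑-distrib-+ (λ i → W i · g i) f))
      (trans (sum-cong-≗ pointwise) (∑-distrib-+ (λ i → W i · f i) g))
      where
      pointwise : ∀ i → W i · g i + f i ≡ W i · f i + g i
      pointwise i with W i in eq
      ... | true  = R.+-comm (g i) (f i)
      ... | false = cong (0# +_) (h i eq)

-- Ancestors, paths and levels in a rooted tree.

module TreeProperties (tree : RootedTree) where
  open RootedTree tree

  iterate-+ : ∀ v j k → iterate parent v (j ℕ.+ k) ≡ iterate parent (iterate parent v j) k
  iterate-+ v zero    k = refl
  iterate-+ v (suc j) k = iterate-+ (parent v) j k

  iterate-fixed : ∀ {v} k → parent v ≡ v → iterate parent v k ≡ v
  iterate-fixed     zero    eq = refl
  iterate-fixed {v} (suc k) eq = trans (cong (λ w → iterate parent w k) eq) (iterate-fixed k eq)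

  iterate-period : ∀ {v} j → iterate parent v j ≡ v → ∀ k → iterate parent v (k ℕ.* j) ≡ v
  iterate-period j eq zero = refl
  iterate-period {v} j eq (suc k) = trans (iterate-+ v j (k ℕ.* j))
    (trans (cong (λ w → iterate parent w (k ℕ.* j)) eq) (iterate-period j eq k))

  -- If `k` steps lead from `v` to the root, then going round the cycle `k` times takes at least `k`
  -- steps, reaches the root and stays there, yet ends at `v`.
  cycle⇒root : ∀ {v} j → iterate parent v (suc j) ≡ v → v ≡ root
  cycle⇒root {v} j eq with rooted v
  ... | k , h = begin
    v                                                    ≡⟨ iterate-period (suc j) eq k ⟨
    iterate parent v (k ℕ.* suc j)                       ≡⟨ cong (iterate parent v) (ℕ.*-suc k j) ⟩
    iterate parent v (k ℕ.+ k ℕ.* j)                     ≡⟨ iterate-+ v k (k ℕ.* j) ⟩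
    iterate parent (iterate parent v k) (k ℕ.* j)        ≡⟨ cong (λ w → iterate parent w (k ℕ.* j)) h ⟩
    iterate parent root (k ℕ.* j)                        ≡⟨ iterate-fixed (k ℕ.* j) parent-root ⟩
    root                                                 ∎
    where open ≡-Reasoning

  ≼-refl : ∀ {v} → v ≼ v
  ≼-refl = 0 , refl

  ≼-trans : ∀ {u v w} → u ≼ v → v ≼ w → u ≼ w
  ≼-trans {w = w} (j , refl) (k , refl) = k ℕ.+ j , iterate-+ w k j

  parent-≼ : ∀ v → parent v ≼ v
  parent-≼ v = 1 , refl

  root-≼ : ∀ v → root ≼ v
  root-≼ = rooted

  ≼-parent : ∀ {v u} → v ≼ u → v ≢ u → v ≼ parent u
  ≼-parent (zero  , eq) v≢u = contradiction (sym eq) v≢u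
  ≼-parent (suc k , eq) v≢u = k , eq

  ≼-antisym : ∀ {u v} → u ≼ v → v ≼ u → u ≡ v
  ≼-antisym {u} {v} (zero  , eq) _ = sym eq
  ≼-antisym {u} {v} (suc j , eq) (k , eq′) = trans u≡root (sym v≡root)
    where
    v≡root : v ≡ root
    v≡root = cycle⇒root (j ℕ.+ k)
      (trans (iterate-+ v (suc j) k) (trans (cong (λ w → iterate parent w k) eq) eq′))
    u≡root : u ≡ root
    u≡root = trans (sym eq) (trans (cong (λ w → iterate parent w (suc j)) v≡root)
      (iterate-fixed (suc j) parent-root))

  ∈-path⁺ : ∀ {v w u} → v ≼ u → u ≼ w → u ∈ path v w
  ∈-path⁺ {v} {w} {u} v≼u u≼w = lookup⇒∈ (trans (lookup∘tabulate _ u)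
    (dec-true ((v ≼? u) ×-dec (u ≼? w)) (v≼u , u≼w)))

  ∈-path⁻ : ∀ v w {u} → u ∈ path v w → v ≼ u × u ≼ w
  ∈-path⁻ v w {u} u∈ with (v ≼? u) ×-dec (u ≼? w) in eq
  ... | yes h = h
  ... | no  _ with () ← trans (sym (trans (lookup∘tabulate _ u) (cong does eq))) (∈⇒lookup u∈)

  closed-≼ : ∀ {S} → IsRootedSubtree S → ∀ {u v} → u ≼ v → v ∈ S → u ∈ S
  closed-≼ closed           (zero  , refl) v∈S = v∈S
  closed-≼ closed {v = v} (suc k , eq)   v∈S = closed-≼ closed (k , eq) (proj₂ closed v v∈S)

  level : Node → ℕ
  level v = ∣ path root v ∣

  level-positive : ∀ v → 0 ℕ.< level v
  level-positive v = ℕ.≤-<-trans ℕ.z≤n (x∈p⇒∣p-x∣<∣p∣ (∈-path⁺ (root-≼ v) ≼-refl))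

  level-< : ∀ {u v} → u ≼ v → u ≢ v → level u ℕ.< level v
  level-< {u} {v} u≼v u≢v = p⊂q⇒∣p∣<∣q∣
    ( (λ w∈ → let r≼w , w≼u = ∈-path⁻ root u w∈ in ∈-path⁺ r≼w (≼-trans w≼u u≼v))
    , v , ∈-path⁺ (root-≼ v) ≼-refl
    , λ v∈ → u≢v (≼-antisym u≼v (proj₂ (∈-path⁻ root u v∈))) )

  -- Since `depth` is a maximum over leaves only, one descends from `v` through children until a
  -- leaf is met. Levels increase strictly and never exceed `size`, so `size` steps suffice.
  level≤depth : ∀ v → level v ℕ.≤ depth
  level≤depth v = climb size v (ℕ.m≤n⇒m≤n+o (level v) ℕ.≤-refl)
    where
    climb : ∀ fuel v → size ℕ.≤ fuel ℕ.+ level v → level v ℕ.≤ depth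
    climb fuel v h with leaf? v
    ... | yes leaf = All.lookup (xs≤max 0 (map level (filter leaf? (allFin size))))
      (List.∈-map⁺ level (List.∈-filter⁺ leaf? (List.∈-allFin v) leaf))
    ... | no ¬leaf with Fin.¬∀⟶∃¬ size _ (λ u → (parent u Fin.≟ v) →-dec (u Fin.≟ root)) ¬leaf
    ...   | w , ¬h = ℕ.≤-trans (ℕ.<⇒≤ v<w) (next fuel h)
      where
      w-child : parent w ≡ v
      w-child = decidable-stable (parent w Fin.≟ v) (λ ¬child → ¬h (λ child → contradiction child ¬child))
      v<w : level v ℕ.< level w
      v<w = level-< (1 , w-child)
        λ v≡w → ¬h λ _ → cycle⇒root 0 (trans w-child v≡w)
      next : ∀ fuel → size ℕ.≤ fuel ℕ.+ level v → level w ℕ.≤ depth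
      next zero h = contradiction (ℕ.<-≤-trans v<w (∣p∣≤n (path root w))) (ℕ.≤⇒≯ h)
      next (suc fuel) h = climb fuel w (ℕ.≤-trans h
        (ℕ.≤-trans (ℕ.≤-reflexive (sym (ℕ.+-suc fuel (level v)))) (ℕ.+-monoʳ-≤ fuel v<w)))

-- What a single fall spends, and on which nodes.

module FallProperties {a ℓ} (F : OrderedField a ℓ) (T : MLAPD.WeightedTree F) where
  open OrderedField F
  open FieldProperties F
  open MLAPD F
  open WeightedTree T
  open TreeProperties tree
  open OnTree T

  paid : Prices → Node → Carrier
  paid p u = cost u - p u

  -- What has been spent on u: its cost if it belongs to the current service,
  -- plus the discounts received since its price was last reset.
  outlay : Subset size → Prices → Node → Carrier
  outlay S p u = lookup S u · cost u + paid p u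

  -- The field `full` persists because a node's price is reset when it joins the service and later
  -- paths leave out the nodes of the service. So a served node carries no discount, and its outlay
  -- is exactly its cost.
  record Valid (S : Subset size) (p : Prices) : Set (a Level.⊔ ℓ) where
    field
      nonneg : ∀ u → 0# ≤ p u
      ≤cost  : ∀ u → p u ≤ cost u
      full   : ∀ u → lookup S u ≡ true → p u ≡ cost u
  open Valid public

  cost-nonneg : ∀ u → 0# ≤ cost u
  cost-nonneg u = proj₁ (cost-positive u)

  paid-nonneg : ∀ {S p} → Valid S p → ∀ u → 0# ≤ paid p u
  paid-nonneg ok u = x≤y⇒0≤y-x (≤cost ok u)

  paid-full : ∀ {S p} → Valid S p → ∀ u → lookup S u ≡ true → paid p u ≡ 0#
  paid-full ok u u∈S = trans (cong (λ x → cost u - x) (full ok u u∈S)) (R.-‿inverseʳ (cost u))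

  -- A bought node gains its full cost and loses the discount `cost u - p u` collected so far; the
  -- net gain is the price at which it was bought. Together with `outlay-discount` this makes the
  -- growth of the outlay equal to the budget spent.
  outlay-buy : ∀ X S p u →
    outlay (S ∪ (X ─ S)) (reset (X ─ S) p) u ≡ outlay S p u + lookup (X ─ S) u · p u
  outlay-buy X S p u rewrite lookup-∪─ S X S u | lookup-─ X S u with lookup S u | lookup X u
  ... | true  | true  = sym (R.+-identityʳ _)
  ... | true  | false = sym (R.+-identityʳ _)
  ... | false | false = sym (R.+-identityʳ _)
  ... | false | true  = begin
    cost u + (cost u - cost u)      ≡⟨ cong (cost u +_) (R.-‿inverseʳ (cost u)) ⟩
    cost u + 0#                     ≡⟨ R.+-comm (cost u) 0# ⟩
    0# + cost u                     ≡⟨ cong (0# +_) ([x-y]+y≡x (cost u) (p u)) ⟨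
    0# + ((cost u - p u) + p u)     ≡⟨ R.+-assoc 0# (cost u - p u) (p u) ⟨
    (0# + (cost u - p u)) + p u     ∎
    where open ≡-Reasoning

  valid-buy : ∀ X S p → Valid S p → Valid (S ∪ (X ─ S)) (reset (X ─ S) p)
  valid-buy X S p ok = record { nonneg = nonneg′ ; ≤cost = ≤cost′ ; full = full′ }
    where
    nonneg′ : ∀ u → 0# ≤ reset (X ─ S) p u
    nonneg′ u with lookup (X ─ S) u
    ... | true  = cost-nonneg u
    ... | false = nonneg ok u
    ≤cost′ : ∀ u → reset (X ─ S) p u ≤ cost u
    ≤cost′ u with lookup (X ─ S) u
    ... | true  = ≤-refl
    ... | false = ≤cost ok u
    full′ : ∀ u → lookup (S ∪ (X ─ S)) u ≡ true → reset (X ─ S) p u ≡ cost u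
    full′ u rewrite lookup-∪─ S X S u | lookup-─ X S u with lookup S u in u∈S | lookup X u
    ... | true  | true  = λ _ → full ok u u∈S
    ... | true  | false = λ _ → full ok u u∈S
    ... | false | true  = λ _ → refl
    ... | false | false = λ ()

  outlay-discount : ∀ P S p q u →
    outlay S (discount P (1# - q) p) u ≡ outlay S p u + lookup P u · (p u * q)
  outlay-discount P S p q u with lookup P u
  ... | false = sym (R.+-identityʳ _)
  ... | true  = +-cancelʳ-≡ (p u * (1# - q)) (begin
    (s + (cost u - d)) + d              ≡⟨ R.+-assoc s (cost u - d) d ⟩
    s + ((cost u - d) + d)              ≡⟨ cong (s +_) (trans ([x-y]+y≡x (cost u) d) (sym ([x-y]+y≡x (cost u) (p u)))) ⟩
    s + ((cost u - p u) + p u)          ≡⟨ cong (λ x → s + ((cost u - p u) + x)) (x*[1-y]+x*y≡x (p u) q) ⟨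
    s + ((cost u - p u) + (d + p u * q)) ≡⟨ solve 4 (λ s m d x → s :+ (m :+ (d :+ x)) := ((s :+ m) :+ x) :+ d) refl s (cost u - p u) d (p u * q) ⟩
    ((s + (cost u - p u)) + p u * q) + d ∎)
    where
    open ≡-Reasoning
    s = lookup S u · cost u
    d = p u * (1# - q)

  valid-discount : ∀ X S p q → 0# ≤ q → q ≤ 1# → Valid S p → Valid S (discount (X ─ S) (1# - q) p)
  valid-discount X S p q 0≤q q≤1 ok = record { nonneg = nonneg′ ; ≤cost = ≤cost′ ; full = full′ }
    where
    nonneg′ : ∀ u → 0# ≤ discount (X ─ S) (1# - q) p u
    nonneg′ u with lookup (X ─ S) u
    ... | true  = *-nonneg (nonneg ok u) (x≤y⇒0≤y-x q≤1)
    ... | false = nonneg ok u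
    ≤cost′ : ∀ u → discount (X ─ S) (1# - q) p u ≤ cost u
    ≤cost′ u with lookup (X ─ S) u
    ... | true  = ≤-trans
      (subst (p u * (1# - q) ≤_) (x*[1-y]+x*y≡x (p u) q) (x≤x+y _ (*-nonneg (nonneg ok u) 0≤q)))
      (≤cost ok u)
    ... | false = ≤cost ok u
    full′ : ∀ u → lookup S u ≡ true → discount (X ─ S) (1# - q) p u ≡ cost u
    full′ u u∈S rewrite lookup-─ X S u | u∈S | ∧-zeroʳ (lookup X u) = full ok u u∈S

  ∈-path─ : ∀ v w S {u} → lookup (path v w ─ S) u ≡ true → (v ≼ u × u ≼ w) × u ∉ S
  ∈-path─ v w S {u} eq
    with lookup (path v w) u in x | lookup S u in s | trans (sym (lookup-─ (path v w) S u)) eq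
  ... | true | false | _ = ∈-path⁻ v w (lookup⇒∈ x) , lookup⇒∉ s

  _deadline≤_ : Request → Request → Set ℓ
  γ deadline≤ δ = deadline γ ≤ deadline δ

  -- The budget is bounded from both sides: `within` always holds, with equality in `exhausted`. A
  -- listed request `δ` that stays outside the service forces the loop to stop at a discount, no
  -- later than at `δ`; so the budget is used up, and only on paths to requests that are at least as
  -- urgent as `δ`.
  record FallSpec (v : Node) (γs : List Request) (b : Carrier) (S : Subset size) (p : Prices)
                  (r : FallResult) : Set (a Level.⊔ ℓ) where
    field
      grows  : ∀ {u} → u ∈ S → u ∈ service r
      valid  : Valid (service r) (newPrices r)
      rising : ∀ u → outlay S p u ≤ outlay (service r) (newPrices r) u
      below  : ∀ u → outlay S p u ≡ outlay (service r) (newPrices r) u ⊎ (v ≼ u × u ∉ S)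
      within : sum (outlay (service r) (newPrices r)) ≤ sum (outlay S p) + b
      exhausted : ∀ {δ} → δ List.∈ γs → node δ ∉ service r →
        sum (outlay (service r) (newPrices r)) ≡ sum (outlay S p) + b ×
        (∀ u → outlay S p u ≡ outlay (service r) (newPrices r) u ⊎
               Any (λ γ → v ≼ u × u ≼ node γ × γ deadline≤ δ) γs)

  open FallSpec public

  fallLoop-spec : ∀ v γs b A S p → All (λ γ → v ≼ node γ) γs → AllPairs _deadline≤_ γs →
    0# ≤ b → Valid S p → FallSpec v γs b S p (fallLoop v γs b A S p)
  fallLoop-spec v [] b A S p _ _ 0≤b ok = record
    { grows = λ u∈S → u∈S ; valid = ok ; rising = λ _ → ≤-refl ; below = λ _ → inj₁ refl
    ; within = x≤x+y _ 0≤b ; exhausted = λ () }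
  fallLoop-spec v (γ ∷ γs) b A S p (v≼γ ∷ v≼γs) (γ≤γs ∷ sorted) 0≤b ok
    with total p (path v (node γ) ─ S) ≤? b
  ... | yes t≤b = record
    { grows  = λ u∈S → grows rec (∪─-grows X S u∈S)
    ; valid  = valid rec
    ; rising = λ u → ≤-trans (subst (outlay S p u ≤_) (sym (outlay-buy X S p u))
        (x≤x+y _ (·-nonneg (lookup P u) (nonneg ok u)))) (rising rec u)
    ; below  = below′
    ; within = ≤-trans (within rec) (≤-reflexive spent)
    ; exhausted = exhausted′
    }
    where
    X = path v (node γ)
    P = X ─ S
    S₁ = S ∪ P
    p₁ = reset P p
    r = fallLoop v γs (b - total p P) (A ∪ P) S₁ p₁
    rec = fallLoop-spec v γs (b - total p P) (A ∪ P) S₁ p₁ v≼γs sorted (x≤y⇒0≤y-x t≤b) (valid-buy X S p ok)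

    spent : sum (outlay S₁ p₁) + (b - total p P) ≡ sum (outlay S p) + b
    spent = begin
      sum (outlay S₁ p₁) + (b - total p P)
        ≡⟨ cong (_+ (b - total p P)) (trans (sum-cong-≗ (outlay-buy X S p)) (∑-distrib-+ (outlay S p) (λ u → lookup P u · p u))) ⟩
      (sum (outlay S p) + total p P) + (b - total p P)
        ≡⟨ solve 3 (λ x y z → (x :+ y) :+ z := x :+ (z :+ y)) refl (sum (outlay S p)) (total p P) (b - total p P) ⟩
      sum (outlay S p) + ((b - total p P) + total p P)
        ≡⟨ cong (sum (outlay S p) +_) ([x-y]+y≡x b (total p P)) ⟩
      sum (outlay S p) + b ∎
      where open ≡-Reasoning

    unchanged : ∀ u → lookup P u ≡ false → outlay S p u ≡ outlay S₁ p₁ u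
    unchanged u u∉P = sym (trans (outlay-buy X S p u)
      (trans (cong (λ w → outlay S p u + w · p u) u∉P) (R.+-identityʳ _)))

    below′ : ∀ u → outlay S p u ≡ outlay (service r) (newPrices r) u ⊎ (v ≼ u × u ∉ S)
    below′ u with trueOrFalse (lookup P u) | below rec u
    ... | inj₁ eq | _                  = let (v≼u , _) , u∉S = ∈-path─ v (node γ) S eq in inj₂ (v≼u , u∉S)
    ... | inj₂ eq | inj₁ same          = inj₁ (trans (unchanged u eq) same)
    ... | inj₂ eq | inj₂ (v≼u , u∉S₁)  = inj₂ (v≼u , u∉S₁ ∘ ∪─-grows X S)

    exhausted′ : ∀ {δ} → δ List.∈ γ ∷ γs → node δ ∉ service r →
      sum (outlay (service r) (newPrices r)) ≡ sum (outlay S p) + b ×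
      (∀ u → outlay S p u ≡ outlay (service r) (newPrices r) u ⊎
             Any (λ ε → v ≼ u × u ≼ node ε × ε deadline≤ δ) (γ ∷ γs))
    exhausted′ (here refl) δ∉ = contradiction (grows rec (∪─-covers X S (∈-path⁺ v≼γ ≼-refl))) δ∉
    exhausted′ {δ} (there δ∈) δ∉ = trans (proj₁ (exhausted rec δ∈ δ∉)) spent , touched
      where
      touched : ∀ u → outlay S p u ≡ outlay (service r) (newPrices r) u ⊎
                Any (λ ε → v ≼ u × u ≼ node ε × ε deadline≤ δ) (γ ∷ γs)
      touched u with trueOrFalse (lookup P u) | proj₂ (exhausted rec δ∈ δ∉) u
      ... | inj₁ eq | _         = let (v≼u , u≼γ) , _ = ∈-path─ v (node γ) S eq in
                                inj₂ (here (v≼u , u≼γ , All.lookup γ≤γs δ∈))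
      ... | inj₂ eq | inj₁ same = inj₁ (trans (unchanged u eq) same)
      ... | inj₂ eq | inj₂ h    = inj₂ (there h)
  ... | no t≰b = record
    { grows  = λ u∈S → u∈S
    ; valid  = valid-discount X S p q 0≤q (ratio≤1 b≤t 0≤t t≢0) ok
    ; rising = λ u → subst (outlay S p u ≤_) (sym (outlay-discount P S p q u))
        (x≤x+y _ (·-nonneg (lookup P u) (*-nonneg (nonneg ok u) 0≤q)))
    ; below  = below′
    ; within = ≤-reflexive spent
    ; exhausted = λ δ∈ _ → spent , touched δ∈
    }
    where
    X = path v (node γ)
    P = X ─ S
    t = total p P
    q = b * t ⁻¹
    b≤t : b ≤ t
    b≤t with ≤-total b t
    ... | inj₁ h = h
    ... | inj₂ h = contradiction h t≰b
    0≤t : 0# ≤ t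
    0≤t = ≤-trans 0≤b b≤t
    -- The inverse of zero is unconstrained, so the ratio needs this: a path of total price zero
    -- would have fitted the budget.
    t≢0 : t ≢ 0#
    t≢0 eq = t≰b (subst (_≤ b) (sym eq) 0≤b)
    0≤q : 0# ≤ q
    0≤q = *-nonneg 0≤b (⁻¹-nonneg 0≤t t≢0)
    p′ = discount P (1# - q) p

    spent : sum (outlay S p′) ≡ sum (outlay S p) + b
    spent = begin
      sum (outlay S p′)
        ≡⟨ trans (sum-cong-≗ (outlay-discount P S p q)) (∑-distrib-+ (outlay S p) (λ u → lookup P u · (p u * q))) ⟩
      sum (outlay S p) + sum (λ u → lookup P u · (p u * q))
        ≡⟨ cong (sum (outlay S p) +_) (sum-cong-≗ λ u → ·-*-assoc (lookup P u) (p u) q) ⟩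
      sum (outlay S p) + sum (λ u → lookup P u · p u * q)
        ≡⟨ cong (sum (outlay S p) +_) (*-distribʳ-sum q (λ u → lookup P u · p u)) ⟨
      sum (outlay S p) + t * q
        ≡⟨ cong (sum (outlay S p) +_) (solve 3 (λ t b i → t :* (b :* i) := b :* (t :* i)) refl t b (t ⁻¹)) ⟩
      sum (outlay S p) + b * (t * t ⁻¹)
        ≡⟨ cong (λ x → sum (outlay S p) + b * x) (*-inverseʳ t t≢0) ⟩
      sum (outlay S p) + b * 1#
        ≡⟨ cong (sum (outlay S p) +_) (R.*-identityʳ b) ⟩
      sum (outlay S p) + b ∎
      where open ≡-Reasoning

    unchanged : ∀ u → lookup P u ≡ false → outlay S p u ≡ outlay S p′ u
    unchanged u u∉P = sym (trans (outlay-discount P S p q u)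
      (trans (cong (λ w → outlay S p u + w · (p u * q)) u∉P) (R.+-identityʳ _)))

    below′ : ∀ u → outlay S p u ≡ outlay S p′ u ⊎ (v ≼ u × u ∉ S)
    below′ u with trueOrFalse (lookup P u)
    ... | inj₁ eq = let (v≼u , _) , u∉S = ∈-path─ v (node γ) S eq in inj₂ (v≼u , u∉S)
    ... | inj₂ eq = inj₁ (unchanged u eq)

    γ≤ : ∀ {δ} → δ List.∈ γ ∷ γs → γ deadline≤ δ
    γ≤ (here refl) = ≤-refl
    γ≤ (there δ∈)  = All.lookup γ≤γs δ∈

    touched : ∀ {δ} → δ List.∈ γ ∷ γs → ∀ u → outlay S p u ≡ outlay S p′ u ⊎
              Any (λ ε → v ≼ u × u ≼ node ε × ε deadline≤ δ) (γ ∷ γs)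
    touched δ∈ u with trueOrFalse (lookup P u)
    ... | inj₁ eq = let (v≼u , u≼γ) , _ = ∈-path─ v (node γ) S eq in inj₂ (here (v≼u , u≼γ , γ≤ δ∈))
    ... | inj₂ eq = inj₁ (unchanged u eq)

  -- The path to a request starts at `v`, which is already in the service, and every later node of
  -- the path has its parent on the path.
  fallLoop-closed : ∀ v γs b A S p → IsRootedSubtree S → v ∈ S →
    IsRootedSubtree (service (fallLoop v γs b A S p))
  fallLoop-closed v [] b A S p closed v∈S = closed
  fallLoop-closed v (γ ∷ γs) b A S p closed v∈S with total p (path v (node γ) ─ S) ≤? b
  ... | no  _ = closed
  ... | yes _ = fallLoop-closed v γs _ _ _ _
    (∪─-grows X S (proj₁ closed) , closed′) (∪─-grows X S v∈S)
    where
    X = path v (node γ)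
    closed′ : ∀ u → u ∈ S ∪ (X ─ S) → parent u ∈ S ∪ (X ─ S)
    closed′ u u∈ with ∪─⁻ X S u∈
    ... | inj₁ u∈S = ∪─-grows X S (proj₂ closed u u∈S)
    ... | inj₂ u∈X with ∈-path⁻ v (node γ) u∈X | v Fin.≟ u
    ...   | _           | yes refl = ∪─-grows X S (proj₂ closed u v∈S)
    ...   | v≼u , u≼γ   | no  v≢u  =
      ∪─-covers X S (∈-path⁺ (≼-parent v≼u v≢u) (≼-trans (parent-≼ u) u≼γ))

  fallLoop-split : ∀ {S₀ : Subset size} v γs b A S p →
    (∀ u → Split (lookup S₀ u) (lookup A u) (lookup S u)) →
    let r = fallLoop v γs b A S p in
    ∀ u → Split (lookup S₀ u) (lookup (returned r) u) (lookup (service r) u)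
  fallLoop-split v [] b A S p split = split
  fallLoop-split {S₀} v (γ ∷ γs) b A S p split with total p (path v (node γ) ─ S) ≤? b
  ... | no  _ = split
  ... | yes _ = fallLoop-split {S₀} v γs _ _ _ _ λ u →
    subst₂ (Split (lookup S₀ u)) (sym (lookup-∪─ A (path v (node γ)) S u)) (sym (lookup-∪─ S (path v (node γ)) S u))
      (split-∪ (lookup (path v (node γ)) u) (split u))

  fall-spec : ∀ pending v S p → AllPairs _deadline≤_ pending → Valid S p →
    FallSpec v (filter (λ γ → v ≼? node γ) pending) (cost v) S p (fall pending v S p)
  fall-spec pending v S p sorted ok = fallLoop-spec v _ _ ⊥ S p
    (All.all-filter (λ γ → v ≼? node γ) pending) (AllPairs.filter⁺ (λ γ → v ≼? node γ) sorted)
    (cost-nonneg v) ok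

  fall-closed : ∀ pending v S p → IsRootedSubtree S → v ∈ S → IsRootedSubtree (service (fall pending v S p))
  fall-closed pending v S p = fallLoop-closed v (filter (λ γ → v ≼? node γ) pending) (cost v) ⊥ S p

  fall-split : ∀ pending v S p → let r = fall pending v S p in
    ∀ u → Split (lookup S u) (lookup (returned r) u) (lookup (service r) u)
  fall-split pending v S p = fallLoop-split {S} v (filter (λ γ → v ≼? node γ) pending) (cost v) ⊥ S p
    λ u → subst (λ w → Split (lookup S u) w (lookup S u)) (sym (lookup-replicate u false)) (split-⊥ (lookup S u))

-- Accounting along the processing of the queue.

module DrainProperties {a ℓ} (F : OrderedField a ℓ) (T : MLAPD.WeightedTree F)
                       (order : MLAPD.OnTree.EnqueueOrder F T) where
  open OrderedField F
  open FieldProperties F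
  open MLAPD F
  open WeightedTree T
  open TreeProperties tree
  open OnTree T
  open FallProperties F T
  open EnqueueOrder order
  open Waterfall order

  sumList : ∀ {n} → (Fin n → Carrier) → List (Fin n) → Carrier
  sumList f = foldr (λ v x → f v + x) 0#

  sumList-++ : ∀ {n} (f : Fin n → Carrier) xs ys → sumList f (xs ++ ys) ≡ sumList f xs + sumList f ys
  sumList-++ f []       ys = sym (R.+-identityˡ _)
  sumList-++ f (x ∷ xs) ys = trans (cong (f x +_) (sumList-++ f xs ys)) (sym (R.+-assoc (f x) _ _))

  sumList-↭ : ∀ {n} (f : Fin n → Carrier) {xs ys} → xs ↭ ys → sumList f xs ≡ sumList f ys
  sumList-↭ f Perm.refl           = refl
  sumList-↭ f (Perm.prep x σ)     = cong (f x +_) (sumList-↭ f σ)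
  sumList-↭ f (Perm.swap {xs} {ys} x y σ) = trans (cong (λ s → f x + (f y + s)) (sumList-↭ f σ))
    (solve 3 (λ x y s → x :+ (y :+ s) := y :+ (x :+ s)) refl (f x) (f y) (sumList f ys))
  sumList-↭ f (Perm.trans σ τ)    = trans (sumList-↭ f σ) (sumList-↭ f τ)

  sumList-suc : ∀ {n} (f : Fin (suc n) → Carrier) xs → sumList f (map suc xs) ≡ sumList (f ∘ suc) xs
  sumList-suc f []       = refl
  sumList-suc f (x ∷ xs) = cong (f (suc x) +_) (sumList-suc f xs)

  sumList-elements : ∀ {n} (f : Fin n → Carrier) X → sumList f (elements X) ≡ sumOn (lookup X) f
  sumList-elements f []          = refl
  sumList-elements f (true  ∷ X) =
    cong (f zero +_) (trans (sumList-suc f (elements X)) (sumList-elements (f ∘ suc) X))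
  sumList-elements f (false ∷ X) =
    trans (sumList-suc f (elements X)) (trans (sumList-elements (f ∘ suc) X) (sym (R.+-identityˡ _)))

  ∈-elements⁻ : ∀ {n} (X : Subset n) {v} → v List.∈ elements X → v ∈ X
  ∈-elements⁻ (true  ∷ X) (here refl) = here
  ∈-elements⁻ (true  ∷ X) (there v∈) with List.∈-map⁻ suc v∈
  ... | _ , w∈ , refl = there (∈-elements⁻ X w∈)
  ∈-elements⁻ (false ∷ X) v∈ with List.∈-map⁻ suc v∈
  ... | _ , w∈ , refl = there (∈-elements⁻ X w∈)

  sumList-arrange : ∀ f t S X → sumList f (arrange t S X) ≡ total f X
  sumList-arrange f t S X = trans (sumList-↭ f (arrange-↭ t S X)) (sumList-elements f X)

  arrange-⊆ : ∀ t S X {Y : Subset size} → X ⊆ Y → All (_∈ Y) (arrange t S X)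
  arrange-⊆ t S X X⊆Y = All.tabulate λ v∈ → X⊆Y (∈-elements⁻ X (Perm.∈-resp-↭ (arrange-↭ t S X) v∈))

  State : Set a
  State = List Node × Subset size × Prices

  -- By `queued`, a dequeued node is already in the service. Its fall pays only for nodes outside
  -- the service, hence only for proper descendants.
  record Good (st : State) : Set (a Level.⊔ ℓ) where
    field
      prices : Valid (proj₁ (proj₂ st)) (proj₂ (proj₂ st))
      closed : IsRootedSubtree (proj₁ (proj₂ st))
      queued : All (_∈ proj₁ (proj₂ st)) (proj₁ st)
  open Good public

  module _ (t : Carrier) (pending : List Request) (sorted : AllPairs _deadline≤_ pending) where

    next : Node → State → State
    next v (Q , S , p) = let r = fall pending v S p in
      Q ++ arrange t (service r) (returned r) , service r , newPrices r

    fall-grows : ∀ v {Q S p} → Good (v ∷ Q , S , p) → S ⊆ service (fall pending v S p)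
    fall-grows v {S = S} {p} good = grows (fall-spec pending v S p sorted (prices good))

    returned⊆service : ∀ v S p → let r = fall pending v S p in returned r ⊆ service r
    returned⊆service v S p {u} u∈A
      with lookup S u | lookup (returned (fall pending v S p)) u in u∈A′
         | lookup (service (fall pending v S p)) u in u∈S′ | fall-split pending v S p u
    ... | _ | true  | true  | _  = lookup⇒∈ u∈S′
    ... | _ | false | _     | _  = contradiction u∈A (lookup⇒∉ u∈A′)

    good-next : ∀ v {Q S p} → Good (v ∷ Q , S , p) → Good (next v (Q , S , p))
    good-next v {Q} {S} {p} good = record
      { prices = valid (fall-spec pending v S p sorted (prices good))
      ; closed = fall-closed pending v S p (closed good) (All.head (queued good))
      ; queued = All.++⁺ (All.map (λ {u} → fall-grows v good {u}) (All.tail (queued good)))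
                         (arrange-⊆ t _ _ (λ {u} → returned⊆service v S p {u}))
      }

    drain-good : ∀ fuel Q S p → Good (Q , S , p) → Good (drain fuel t pending Q S p)
    drain-good zero       []      S p good = good
    drain-good (suc fuel) []      S p good = good
    drain-good zero       (v ∷ Q) S p good = good
    drain-good (suc fuel) (v ∷ Q) S p good = drain-good fuel _ _ _ (good-next v good)

    drain-grows : ∀ fuel Q S p → Good (Q , S , p) → S ⊆ proj₁ (proj₂ (drain fuel t pending Q S p))
    drain-grows zero       []      S p good u∈S = u∈S
    drain-grows (suc fuel) []      S p good u∈S = u∈S
    drain-grows zero       (v ∷ Q) S p good u∈S = u∈S
    drain-grows (suc fuel) (v ∷ Q) S p good u∈S =
      drain-grows fuel _ _ _ (good-next v good) (fall-grows v good u∈S)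

    -- The set `S*` stands for the final service and is fixed in advance, because whether a node is
    -- stuck depends on the outcome of the whole service. Services only grow, so each intermediate
    -- one lies within `S*`. The relation is left general so that upper and lower bounds on the
    -- spending share one induction.
    drain-preorder : ∀ {r} (_≲_ : State → State → Set r) →
      (∀ {x} → x ≲ x) → (∀ {x y z} → x ≲ y → y ≲ z → x ≲ z) →
      (S* : Subset size) →
      (∀ v Q S p → Good (v ∷ Q , S , p) → service (fall pending v S p) ⊆ S* →
        (v ∷ Q , S , p) ≲ next v (Q , S , p)) →
      ∀ fuel Q S p → Good (Q , S , p) → proj₁ (proj₂ (drain fuel t pending Q S p)) ⊆ S* →
      (Q , S , p) ≲ drain fuel t pending Q S p
    drain-preorder _≲_ ≲-refl ≲-trans S* step zero       []      S p good ⊆S* = ≲-refl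
    drain-preorder _≲_ ≲-refl ≲-trans S* step (suc fuel) []      S p good ⊆S* = ≲-refl
    drain-preorder _≲_ ≲-refl ≲-trans S* step zero       (v ∷ Q) S p good ⊆S* = ≲-refl
    drain-preorder _≲_ ≲-refl ≲-trans S* step (suc fuel) (v ∷ Q) S p good ⊆S* = ≲-trans
      (step v Q S p good (λ u∈ → ⊆S* (drain-grows fuel _ _ _ (good-next v good) u∈)))
      (drain-preorder _≲_ ≲-refl ≲-trans S* step fuel _ _ _ (good-next v good) ⊆S*)

    balance : (Node → Bool) → (Node → Carrier) → State → Carrier
    balance W f (Q , S , p) = sumOn W (outlay S p) + sumList f Q

    -- Along a run, the outlay on W grows by at most the charges f of the
    -- dequeued nodes; these are the nodes of the service that are not queued.
    Charged : (Node → Bool) → (Node → Carrier) → State → State → Set ℓ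
    Charged W f x y = balance W f y + total f (proj₁ (proj₂ x)) ≤ balance W f x + total f (proj₁ (proj₂ y))

    charged-trans : ∀ W f x y z → Charged W f x y → Charged W f y z → Charged W f x z
    charged-trans W f x y z xy yz = ≤-shift
      (solve 6 (λ x y z x′ y′ z′ → (z :+ x′) :+ ((x :+ y′) :+ (y :+ z′)) := (x :+ z′) :+ ((y :+ x′) :+ (z :+ y′)))
        refl (balance W f x) (balance W f y) (balance W f z) (tot x) (tot y) (tot z))
      (+-mono-≤ xy yz)
      where
      tot : State → Carrier
      tot st = total f (proj₁ (proj₂ st))

    module _ (W : Node → Bool) (f : Node → Carrier) (v : Node) (Q : List Node) (S : Subset size) (p : Prices) where
      private
        r = fall pending v S p
        A = sumOn W (outlay S p)
        A′ = sumOn W (outlay (service r) (newPrices r))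
        L = sumList f Q
        TS = total f S
        TA = total f (returned r)

        balance-next : balance W f (next v (Q , S , p)) ≡ A′ + (L + TA)
        balance-next = cong (A′ +_) (trans (sumList-++ f Q _)
          (cong (L +_) (sumList-arrange f t (service r) (returned r))))

        total-service : total f (service r) ≡ TS + TA
        total-service = trans (sum-cong-≗ bits)
          (∑-distrib-+ (λ u → lookup S u · f u) (λ u → lookup (returned r) u · f u))
          where
          bits : ∀ u → lookup (service r) u · f u ≡ lookup S u · f u + lookup (returned r) u · f u
          bits u with lookup S u | lookup (returned r) u | lookup (service r) u | fall-split pending v S p u
          ... | _ | _ | _ | old     = sym (R.+-identityʳ _)
          ... | _ | _ | _ | new     = sym (R.+-identityˡ _)
          ... | _ | _ | _ | outside = sym (R.+-identityˡ _)

      -- The returned nodes add the same charge to the queue and to the service. What remains is the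
      -- charge `f v` leaving the queue, to be compared with the growth of the outlay.
      charged-next : A′ ≤ A + f v → Charged W f (v ∷ Q , S , p) (next v (Q , S , p))
      charged-next h rewrite balance-next | total-service = ≤-shift
        (solve 6 (λ a a′ l ts ta fv → ((a′ :+ (l :+ ta)) :+ ts) :+ (a :+ fv) := ((a :+ (fv :+ l)) :+ (ts :+ ta)) :+ a′)
          refl A A′ L TS TA (f v)) h

      charged-next⁻ : A + f v ≤ A′ → Charged W f (next v (Q , S , p)) (v ∷ Q , S , p)
      charged-next⁻ h rewrite balance-next | total-service = ≤-shift
        (solve 6 (λ a a′ l ts ta fv → ((a :+ (fv :+ l)) :+ (ts :+ ta)) :+ a′ := ((a′ :+ (l :+ ta)) :+ ts) :+ (a :+ fv))
          refl A A′ L TS TA (f v)) h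

-- One complete service.

module ServeProperties {a ℓ} (F : OrderedField a ℓ) (T : MLAPD.WeightedTree F)
                       (order : MLAPD.OnTree.EnqueueOrder F T) where
  open OrderedField F
  open FieldProperties F
  open MLAPD F
  open WeightedTree T
  open TreeProperties tree
  open OnTree T
  open FallProperties F T
  open DrainProperties F T order
  open EnqueueOrder order
  open Waterfall order

  valid-reset : ∀ {X p} S → Valid X p → Valid S (reset S p)
  valid-reset {p = p} S ok = record { nonneg = nonneg′ ; ≤cost = ≤cost′ ; full = full′ }
    where
    nonneg′ : ∀ u → 0# ≤ reset S p u
    nonneg′ u with lookup S u
    ... | true  = cost-nonneg u
    ... | false = nonneg ok u
    ≤cost′ : ∀ u → reset S p u ≤ cost u
    ≤cost′ u with lookup S u
    ... | true  = ≤-refl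
    ... | false = ≤cost ok u
    full′ : ∀ u → lookup S u ≡ true → reset S p u ≡ cost u
    full′ u eq rewrite eq = refl

  path-closed : ∀ w → IsRootedSubtree (path root w)
  path-closed w = ∈-path⁺ ≼-refl (root-≼ w) , λ u u∈ →
    ∈-path⁺ (root-≼ (parent u)) (≼-trans (parent-≼ u) (proj₂ (∈-path⁻ root w u∈)))

  module Serving (pending : List Request) (sorted : AllPairs _deadline≤_ pending)
                 (ρ : Request) {X : Subset size} (p : Prices) (ok : Valid X p) where

    t  = deadline ρ
    S₀ = path root (node ρ)
    Q₀ = arrange t S₀ S₀
    p₀ = reset S₀ p
    S* = nodes (proj₁ (serve pending ρ p))
    p* = proj₂ (serve pending ρ p)

    private
      fuel  = length Q₀ ℕ.+ ∣ ∁ S₀ ∣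
      final = drain fuel t pending Q₀ S₀ p₀

      good₀ : Good (Q₀ , S₀ , p₀)
      good₀ = record
        { prices = valid-reset S₀ ok
        ; closed = path-closed (node ρ)
        ; queued = arrange-⊆ t S₀ S₀ λ u∈ → u∈
        }

      good* : Good final
      good* = drain-good t pending sorted fuel Q₀ S₀ p₀ good₀

      emptied : proj₁ final ≡ []
      emptied = drain-exhausts fuel t pending Q₀ S₀ p₀ ℕ.≤-refl

    valid* : Valid S* p*
    valid* = prices good*

    closed* : IsRootedSubtree S*
    closed* = closed good*

    S₀⊆S* : S₀ ⊆ S*
    S₀⊆S* = drain-grows t pending sorted fuel Q₀ S₀ p₀ good₀

    -- The queue starts with all of `S₀`, receives every other node of `S*` once, and ends empty. So
    -- the charges of the individual falls add up to `total f S*`.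
    serve-≤ : ∀ W f →
      (∀ v S p → v ∈ S → Valid S p → let r = fall pending v S p in service r ⊆ S* →
        sumOn W (outlay (service r) (newPrices r)) ≤ sumOn W (outlay S p) + f v) →
      sumOn W (outlay S* p*) ≤ sumOn W (outlay S₀ p₀) + total f S*
    serve-≤ W f step = ≤-shift
      (solve 4 (λ x y s s* → x :+ ((y :+ s) :+ s*) := (y :+ s*) :+ ((x :+ con 0) :+ s)) refl
        (sumOn W (outlay S* p*)) (sumOn W (outlay S₀ p₀)) (total f S₀) (total f S*))
      (subst₂ (λ Q x → (sumOn W (outlay S* p*) + sumList f Q) + total f S₀
                     ≤ (sumOn W (outlay S₀ p₀) + x) + total f S*)
        emptied (sumList-arrange f t S₀ S₀)
        (drain-preorder t pending sorted (Charged t pending sorted W f) ≤-refl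
          (λ {x} {y} {z} → charged-trans t pending sorted W f x y z) S*
          (λ v Q S p good ⊆S* → charged-next t pending sorted W f v Q S p
            (step v S p (All.head (queued good)) (prices good) ⊆S*))
          fuel Q₀ S₀ p₀ good₀ λ u∈ → u∈))

    serve-≥ : ∀ W f →
      (∀ v S p → v ∈ S → Valid S p → let r = fall pending v S p in service r ⊆ S* →
        sumOn W (outlay S p) + f v ≤ sumOn W (outlay (service r) (newPrices r))) →
      sumOn W (outlay S₀ p₀) + total f S* ≤ sumOn W (outlay S* p*)
    serve-≥ W f step = ≤-shift
      (solve 4 (λ x y s s* → (y :+ s*) :+ ((x :+ con 0) :+ s) := x :+ ((y :+ s) :+ s*)) refl
        (sumOn W (outlay S* p*)) (sumOn W (outlay S₀ p₀)) (total f S₀) (total f S*))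
      (subst₂ (λ Q x → (sumOn W (outlay S₀ p₀) + x) + total f S*
                     ≤ (sumOn W (outlay S* p*) + sumList f Q) + total f S₀)
        emptied (sumList-arrange f t S₀ S₀)
        (drain-preorder t pending sorted (λ x y → Charged t pending sorted W f y x) ≤-refl
          (λ {x} {y} {z} xy yz → charged-trans t pending sorted W f z y x yz xy) S*
          (λ v Q S p good ⊆S* → charged-next⁻ t pending sorted W f v Q S p
            (step v S p (All.head (queued good)) (prices good) ⊆S*))
          fuel Q₀ S₀ p₀ good₀ λ u∈ → u∈))

  -- Runs over all deadlines, and feasibility.

  module Soundness (ρs : List Request) (ρs-sorted : AllPairs _deadline≤_ ρs) where

    record Sound (st : Prices × Schedule) (rest : List Request) : Set (a Level.⊔ ℓ) where
      field
        {last}    : Subset size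
        pricesOk  : Valid last (proj₁ st)
        subtrees  : All (λ s → IsRootedSubtree (nodes s)) (proj₂ st)
        covered   : ∀ {γ} → γ List.∈ ρs → Any (Satisfies γ) (proj₂ st) ⊎ γ List.∈ rest
        remaining : All (List._∈ ρs) rest
        ordered   : AllPairs _deadline≤_ rest
    open Sound public

    pendingAt : Schedule → Request → List Request
    pendingAt σ ρ = filter (pending? σ (deadline ρ)) ρs

    pendingAt-sorted : ∀ σ ρ → AllPairs _deadline≤_ (pendingAt σ ρ)
    pendingAt-sorted σ ρ = AllPairs.filter⁺ (pending? σ (deadline ρ)) ρs-sorted

    sound-init : Sound (cost , []) ρs
    sound-init = record
      { last      = ⊥
      ; pricesOk  = record { nonneg = cost-nonneg ; ≤cost = λ _ → ≤-refl ; full = λ _ _ → refl }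
      ; subtrees  = []
      ; covered   = inj₂
      ; remaining = All.tabulate λ γ∈ → γ∈
      ; ordered   = ρs-sorted
      }

    -- A request whose deadline has already been visited is satisfied: either it was no longer
    -- pending then, or it triggered a service of its own.
    live : ∀ {p σ ρ rest} → Sound (p , σ) (ρ ∷ rest) →
      ∀ {γ} → γ List.∈ ρs → ¬ Any (Satisfies γ) σ → deadline ρ ≤ deadline γ
    live sound γ∈ unsat with covered sound γ∈ | ordered sound
    ... | inj₁ sat         | _         = contradiction sat unsat
    ... | inj₂ (here refl) | _         = ≤-refl
    ... | inj₂ (there γ∈)  | ρ≤ ∷ _    = All.lookup ρ≤ γ∈

    sound-step : ∀ {st ρ rest} → Sound st (ρ ∷ rest) → Sound (onDeadline ρs st ρ) rest
    sound-step {p , σ} {ρ} {rest} sound =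
      if-does (λ st → Sound st rest) (pending? σ (deadline ρ) ρ) (λ _ → served) unserved
      where
      open Serving (pendingAt σ ρ) (pendingAt-sorted σ ρ) ρ p (pricesOk sound)

      unserved : ¬ Pending σ (deadline ρ) ρ → Sound (p , σ) rest
      unserved ¬pending = record
        { pricesOk  = pricesOk sound
        ; subtrees  = subtrees sound
        ; covered   = covered′
        ; remaining = All.tail (remaining sound)
        ; ordered   = AllPairs.tail (ordered sound)
        }
        where
        covered′ : ∀ {γ} → γ List.∈ ρs → Any (Satisfies γ) σ ⊎ γ List.∈ rest
        covered′ γ∈ with covered sound γ∈
        ... | inj₁ sat         = inj₁ sat
        ... | inj₂ (there γ∈′) = inj₂ γ∈′
        ... | inj₂ (here refl) = inj₁ (decidable-stable (any? (satisfies? ρ) σ)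
          λ unsat → ¬pending (arrival≤deadline ρ , unsat))

      served : Sound (p* , (S* at t) ∷ σ) rest
      served = record
        { pricesOk  = valid*
        ; subtrees  = closed* ∷ subtrees sound
        ; covered   = covered′
        ; remaining = All.tail (remaining sound)
        ; ordered   = AllPairs.tail (ordered sound)
        }
        where
        covered′ : ∀ {γ} → γ List.∈ ρs → Any (Satisfies γ) ((S* at t) ∷ σ) ⊎ γ List.∈ rest
        covered′ γ∈ with covered sound γ∈
        ... | inj₁ sat         = inj₁ (there sat)
        ... | inj₂ (there γ∈′) = inj₂ γ∈′
        ... | inj₂ (here refl) = inj₁ (here
          (S₀⊆S* (∈-path⁺ (root-≼ (node ρ)) ≼-refl) , arrival≤deadline ρ , ≤-refl))

    run-invariant : ∀ {r} (I : Prices × Schedule → List Request → Set r) →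
      (∀ {st ρ rest} → Sound st (ρ ∷ rest) → I st (ρ ∷ rest) → I (onDeadline ρs st ρ) rest) →
      ∀ {st} rest → Sound st rest → I st rest →
      Sound (foldl (onDeadline ρs) st rest) [] × I (foldl (onDeadline ρs) st rest) []
    run-invariant I step []         sound inv = sound , inv
    run-invariant I step (ρ ∷ rest) sound inv =
      run-invariant I step rest (sound-step sound) (step sound inv)

  sorted : ∀ ρs → AllPairs _deadline≤_ (sort ρs)
  sorted ρs = Sorted.Sorted⇒AllPairs (DecTotalOrder.totalOrder (On.decTotalOrder decTotalOrder deadline)) (sort-↗ ρs)

  feasible : ∀ R → Feasible R (waterfall R)
  feasible R = subtrees final , All.tabulate satisfied
    where
    open Soundness (sort (requests R)) (sorted (requests R))
    final : Sound (foldl (onDeadline (sort (requests R))) (cost , []) (sort (requests R))) []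
    final = proj₁ (run-invariant (λ _ _ → ⊤) (λ _ _ → tt) (sort (requests R)) sound-init tt)
    satisfied : ∀ {γ} → γ List.∈ requests R → Any (Satisfies γ) (waterfall R)
    satisfied γ∈ with covered final (Perm.∈-resp-↭ (Perm.↭-sym (sort-↭ (requests R))) γ∈)
    ... | inj₁ sat = sat

-- Overdue nodes and the flow of money within one service.

module LedgerProperties {a ℓ} (F : OrderedField a ℓ) (T : MLAPD.WeightedTree F)
                        (order : MLAPD.OnTree.EnqueueOrder F T) where
  open OrderedField F
  open FieldProperties F
  open MLAPD F
  open WeightedTree T
  open TreeProperties tree
  open OnTree T
  open FallProperties F T
  open ServeProperties F T order
  open Waterfall order

  load : Schedule → Node → Carrier
  load []      u = 0#
  load (s ∷ σ) u = lookup (nodes s) u · cost u + load σ u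

  scheduleCost-load : ∀ σ → scheduleCost σ ≡ sum (load σ)
  scheduleCost-load []      = sym (sum-zero {size} λ _ → refl)
  scheduleCost-load (s ∷ σ) = trans (cong (total cost (nodes s) +_) (scheduleCost-load σ))
    (sym (∑-distrib-+ (λ u → lookup (nodes s) u · cost u) (load σ)))

  loadBy : Carrier → Schedule → Node → Carrier
  loadBy τ []      u = 0#
  loadBy τ (s ∷ σ) u = (does (u ∈? nodes s) ∧ does (time s ≤? τ)) · cost u + loadBy τ σ u

  load-nonneg : ∀ σ u → 0# ≤ load σ u
  load-nonneg []      u = ≤-refl
  load-nonneg (s ∷ σ) u =
    ≤-trans (·-nonneg (lookup (nodes s) u) (cost-nonneg u)) (x≤x+y _ (load-nonneg σ u))

  loadBy-nonneg : ∀ τ σ u → 0# ≤ loadBy τ σ u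
  loadBy-nonneg τ []      u = ≤-refl
  loadBy-nonneg τ (s ∷ σ) u = ≤-trans
    (·-nonneg (does (u ∈? nodes s) ∧ does (time s ≤? τ)) (cost-nonneg u)) (x≤x+y _ (loadBy-nonneg τ σ u))

  loadBy≤load : ∀ τ σ u → loadBy τ σ u ≤ load σ u
  loadBy≤load τ []      u = ≤-refl
  loadBy≤load τ (s ∷ σ) u = +-mono-≤ term (loadBy≤load τ σ u)
    where
    term : (does (u ∈? nodes s) ∧ does (time s ≤? τ)) · cost u ≤ lookup (nodes s) u · cost u
    term with u ∈? nodes s
    ... | no  _   = ·-nonneg (lookup (nodes s) u) (cost-nonneg u)
    ... | yes u∈s rewrite ∈⇒lookup u∈s with does (time s ≤? τ)
    ...   | true  = ≤-refl
    ...   | false = cost-nonneg u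

  loadBy-mono : ∀ {τ t} → τ ≤ t → ∀ σ u → loadBy τ σ u ≤ loadBy t σ u
  loadBy-mono τ≤t []      u = ≤-refl
  loadBy-mono {τ} {t} τ≤t (s ∷ σ) u = +-mono-≤ term (loadBy-mono τ≤t σ u)
    where
    term : (does (u ∈? nodes s) ∧ does (time s ≤? τ)) · cost u ≤ (does (u ∈? nodes s) ∧ does (time s ≤? t)) · cost u
    term with does (u ∈? nodes s) | time s ≤? τ | time s ≤? t
    ... | false | _     | _     = ≤-refl
    ... | true  | no  _ | t?    = ·-nonneg (does t?) (cost-nonneg u)
    ... | true  | yes _ | yes _ = ≤-refl
    ... | true  | yes h | no ¬h = contradiction (≤-trans h τ≤t) ¬h

  loadBy-served : ∀ {t} σ u → Any (λ s → u ∈ nodes s × time s ≤ t) σ → cost u ≤ loadBy t σ u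
  loadBy-served {t} (s ∷ σ) u (here (u∈s , s≤t))
    rewrite dec-true (u ∈? nodes s) u∈s | dec-true (time s ≤? t) s≤t = x≤x+y _ (loadBy-nonneg t σ u)
  loadBy-served {t} (s ∷ σ) u (there h) = ≤-trans (loadBy-served σ u h)
    (≤-shift (solve 2 (λ x y → x :+ y := (y :+ x) :+ con 0) refl (loadBy t σ u) w)
      (·-nonneg (does (u ∈? nodes s) ∧ does (time s ≤? t)) (cost-nonneg u)))
    where
    w = (does (u ∈? nodes s) ∧ does (time s ≤? t)) · cost u

  -- The window is half-open: a service at `τ` itself is already counted by `loadBy τ`, so a service
  -- in the window adds a full `cost u` to it.
  ServesBetween : Node → Carrier → Carrier → Service → Set ℓ
  ServesBetween u τ t s = u ∈ nodes s × ¬ time s ≤ τ × time s ≤ t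

  loadBy-advance : ∀ {τ t} → τ ≤ t → ∀ σ u → Any (ServesBetween u τ t) σ →
    loadBy τ σ u + cost u ≤ loadBy t σ u
  loadBy-advance {τ} {t} τ≤t (s ∷ σ) u (here (u∈s , s≰τ , s≤t))
    rewrite dec-true (u ∈? nodes s) u∈s | dec-true (time s ≤? t) s≤t | dec-false (time s ≤? τ) s≰τ =
    ≤-shift (solve 3 (λ x y c → ((con 0 :+ x) :+ c) :+ y := (c :+ y) :+ x) refl
      (loadBy τ σ u) (loadBy t σ u) (cost u)) (loadBy-mono τ≤t σ u)
  loadBy-advance {τ} {t} τ≤t (s ∷ σ) u (there h) = ≤-shift
    (solve 5 (λ x y c w w′ → ((w :+ x) :+ c) :+ (w′ :+ y) := (w′ :+ y) :+ (w :+ (x :+ c))) refl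
      (loadBy τ σ u) (loadBy t σ u) (cost u) (w τ) (w t))
    (+-mono-≤ wτ≤wt (loadBy-advance τ≤t σ u h))
    where
    w : Carrier → Carrier
    w τ = (does (u ∈? nodes s) ∧ does (time s ≤? τ)) · cost u
    wτ≤wt : w τ ≤ w t
    wτ≤wt with does (u ∈? nodes s) | time s ≤? τ | time s ≤? t
    ... | false | _     | _     = ≤-refl
    ... | true  | no  _ | t?    = ·-nonneg (does t?) (cost-nonneg u)
    ... | true  | yes _ | yes _ = ≤-refl
    ... | true  | yes h | no ¬h = contradiction (≤-trans h τ≤t) ¬h

  -- The membership bit of a node in a service and its overdue bits before and
  -- after the service; only a served node can cease to be overdue.
  data Kind : Bool → Bool → Bool → Set where
    timely  : ∀ s → Kind s false false
    stuck   : ∀ s → Kind s true true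
    settled : Kind true true false

  kind-settled : ∀ {s o o*} → Kind s o o* →
    (o ≡ true × o* ≡ false × s ∧ (o ∧ not o*) ≡ true) ⊎ s ∧ (o ∧ not o*) ≡ false
  kind-settled (timely s) = inj₂ (∧-zeroʳ s)
  kind-settled (stuck s)  = inj₂ (∧-zeroʳ s)
  kind-settled settled    = inj₁ (refl , refl , refl)

  module _ (c : Carrier) where

    kind-cost : ∀ {s o o*} → Kind s o o* →
      s · c ≡ ((s ∧ not o) · c + (s ∧ o*) · c) + (s ∧ (o ∧ not o*)) · c
    kind-cost (timely true)  = solve 1 (λ c → c := (c :+ con 0) :+ con 0) refl c
    kind-cost (timely false) = solve 0 (con 0 := (con 0 :+ con 0) :+ con 0) refl
    kind-cost (stuck true)   = solve 1 (λ c → c := (con 0 :+ c) :+ con 0) refl c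
    kind-cost (stuck false)  = solve 0 (con 0 := (con 0 :+ con 0) :+ con 0) refl
    kind-cost settled        = solve 1 (λ c → c := (con 0 :+ con 0) :+ c) refl c

    -- Here `x` is the discount left after the service. The critical kind is `settled`: the node
    -- stops being overdue, so `x` counts on the left while the right side is zero. But such a node
    -- was served, and its discount is gone.
    kind-up : ∀ l {s o o*} x → Kind s o o* → (s ≡ true → x ≡ 0#) →
      l · ((s ∧ not o) · c) + (l ∧ not o*) · x ≤ (l ∧ not o) · (s · c + x)
    kind-up false x k              h = ≤-reflexive (R.+-identityˡ 0#)
    kind-up true  x (timely true)  h = ≤-refl
    kind-up true  x (timely false) h = ≤-refl
    kind-up true  x (stuck true)   h = ≤-reflexive (R.+-identityˡ 0#)
    kind-up true  x (stuck false)  h = ≤-reflexive (R.+-identityˡ 0#)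
    kind-up true  x settled        h = ≤-reflexive (trans (R.+-identityˡ x) (h refl))

    kind-up-charge : ∀ l {s o o*} → Kind s o o* →
      s · ((l ∧ not o*) · c) ≤ l · ((s ∧ not o) · c + (s ∧ (o ∧ not o*)) · c)
    kind-up-charge true  (timely true)  = ≤-reflexive (sym (R.+-identityʳ c))
    kind-up-charge true  (timely false) = ≤-reflexive (sym (R.+-identityʳ 0#))
    kind-up-charge true  (stuck true)   = ≤-reflexive (sym (R.+-identityʳ 0#))
    kind-up-charge true  (stuck false)  = ≤-reflexive (sym (R.+-identityʳ 0#))
    kind-up-charge true  settled        = ≤-reflexive (sym (R.+-identityˡ c))
    kind-up-charge false {true}  k      = ≤-refl
    kind-up-charge false {false} k      = ≤-refl

    -- A served overdue node is stuck or settled, so its cost reappears on the right. Its discount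
    -- is needed on the right only if it stays overdue, since serving a settled node removes the
    -- discount.
    kind-down : ∀ l {s o o*} x → Kind s o o* → (s ≡ true → x ≡ 0#) →
      (l ∧ o) · (s · c + x) ≤ l · ((s ∧ o*) · c + (s ∧ (o ∧ not o*)) · c) + (l ∧ o*) · x
    kind-down false x k              h = ≤-reflexive (sym (R.+-identityˡ 0#))
    kind-down true  x (timely true)  h = ≤-reflexive (solve 0 (con 0 := (con 0 :+ con 0) :+ con 0) refl)
    kind-down true  x (timely false) h = ≤-reflexive (solve 0 (con 0 := (con 0 :+ con 0) :+ con 0) refl)
    kind-down true  x (stuck true)   h = ≤-reflexive (solve 2 (λ c x → c :+ x := (c :+ con 0) :+ x) refl c x)
    kind-down true  x (stuck false)  h = ≤-reflexive (solve 1 (λ x → con 0 :+ x := (con 0 :+ con 0) :+ x) refl x)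
    kind-down true  x settled        h = ≤-reflexive (trans (cong (c +_) (h refl))
      (solve 1 (λ c → c :+ con 0 := (con 0 :+ c) :+ con 0) refl c))

    kind-down-charge : ∀ l s o* → l · ((s ∧ o*) · c) ≤ s · ((l ∧ o*) · c)
    kind-down-charge true  true  o* = ≤-refl
    kind-down-charge true  false o* = ≤-refl
    kind-down-charge false true  o* = ≤-refl
    kind-down-charge false false o* = ≤-refl

  -- upper and upper⁺ select the nodes on levels ≤ k and ≤ k + 1.
  module Ledger
    (ρs : List Request) (ρs-sorted : AllPairs _deadline≤_ ρs)
    (opt : Schedule) (opt-subtrees : All (λ s → IsRootedSubtree (nodes s)) opt)
    (opt-serves : ∀ {γ} → γ List.∈ ρs → Any (Satisfies γ) opt)
    (upper upper⁺ : Node → Bool)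
    (upper-step : ∀ {v u} → v ≼ u → v ≢ u → upper⁺ u ≡ true → upper v ≡ true)
    where
    open Soundness ρs ρs-sorted

    Relieved : Node → Carrier → Carrier → Set (a Level.⊔ ℓ)
    Relieved u τ t = Any (ServesBetween u τ t) opt

    relieved? : ∀ u τ t → Dec (Relieved u τ t)
    relieved? u τ t = any? (λ s → (u ∈? nodes s) ×-dec ¬? (time s ≤? τ) ×-dec (time s ≤? t)) opt

    relieved-≼ : ∀ {v u τ t t′} → v ≼ u → t ≤ t′ → Relieved u τ t → Relieved v τ t′
    relieved-≼ v≼u t≤t′ h with List.find h
    ... | s , s∈ , u∈s , later , earlier =
      List.lose s∈ (closed-≼ (All.lookup opt-subtrees s∈) v≼u u∈s , later , ≤-trans earlier t≤t′)

    relieved-mono : ∀ {u τ τ′ t} → τ ≤ τ′ → Relieved u τ′ t → Relieved u τ t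
    relieved-mono τ≤τ′ = Any.map λ (u∈ , later , earlier) → u∈ , (λ h → later (≤-trans h τ≤τ′)) , earlier

    ¬relieved-instantly : ∀ {u t} → ¬ Relieved u t t
    ¬relieved-instantly h with _ , (_ , later , earlier) ← Any.satisfied h = later earlier

    -- Stated as the absence of a service by `opt` in the window up to the deadline, because a next
    -- service of `u` need not exist.
    Threat : Schedule → Carrier → Node → Request → Set (a Level.⊔ ℓ)
    Threat σ t u γ = u ≼ node γ × Pending σ t γ × ¬ Relieved u t (deadline γ)

    Overdue : Schedule → Carrier → Node → Set (a Level.⊔ ℓ)
    Overdue σ t u = Any (Threat σ t u) ρs

    overdue? : ∀ σ t u → Dec (Overdue σ t u)
    overdue? σ t u = any? (λ γ → (u ≼? node γ) ×-dec pending? σ t γ ×-dec ¬? (relieved? u t (deadline γ))) ρs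

    overdue : Schedule → Carrier → Node → Bool
    overdue σ t u = does (overdue? σ t u)

    overdue⁺ : ∀ {σ t u} → Overdue σ t u → overdue σ t u ≡ true
    overdue⁺ {σ} {t} {u} = dec-true (overdue? σ t u)

    overdue⁻ : ∀ {σ t u} → overdue σ t u ≡ true → Overdue σ t u
    overdue⁻ {σ} {t} {u} = does-true⁻ (overdue? σ t u)

    ¬overdue⁻ : ∀ {σ t u} → overdue σ t u ≡ false → ¬ Overdue σ t u
    ¬overdue⁻ eq h with () ← trans (sym eq) (overdue⁺ h)

    module AtDeadline {p σ ρ rest} (sound : Sound (p , σ) (ρ ∷ rest)) (ρ-pending : Pending σ (deadline ρ) ρ) where
      private pending = pendingAt σ ρ
      open Serving pending (pendingAt-sorted σ ρ) ρ p (pricesOk sound) public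

      σ* = (S* at t) ∷ σ

      before after : Node → Bool
      before = overdue σ t
      after  = overdue σ* t

      -- These are the two sets whose outlay is followed. The first can receive money only from
      -- upper nodes that are not stuck; the second absorbs everything that stuck nodes outside
      -- `upper` spend.
      timelyUpper overdueLower : Node → Bool
      timelyUpper u = upper⁺ u ∧ not (before u)
      overdueLower u = not (upper⁺ u) ∧ before u

      after⇒before : ∀ {u} → Overdue σ* t u → Overdue σ t u
      after⇒before = Any.map λ (u≼γ , (arrived , unsat) , ¬relieved) → u≼γ , (arrived , unsat ∘ there) , ¬relieved

      -- The service is closed under ancestors, so if it misses `u` it satisfies no request below
      -- `u`, and the old witness remains.
      unserved⇒after : ∀ {u} → u ∉ S* → Overdue σ t u → Overdue σ* t u
      unserved⇒after u∉S* = Any.map λ (u≼γ , (arrived , unsat) , ¬relieved) →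
        u≼γ , (arrived , λ { (here (γ∈S* , _)) → u∉S* (closed-≼ closed* u≼γ γ∈S*) ; (there sat) → unsat sat }) , ¬relieved

      kind : ∀ u → Kind (lookup S* u) (before u) (after u)
      kind u with trueOrFalse (before u) | trueOrFalse (after u) | trueOrFalse (lookup S* u)
      ... | inj₂ o | inj₂ o* | _ rewrite o | o* = timely _
      ... | inj₁ o | inj₁ o* | _ rewrite o | o* = stuck _
      ... | inj₁ o | inj₂ o* | inj₁ s rewrite o | o* | s = settled
      ... | inj₁ o | inj₂ o* | inj₂ s = contradiction (unserved⇒after (lookup⇒∉ s) (overdue⁻ o)) (¬overdue⁻ o*)
      ... | inj₂ o | inj₁ o* | _ = contradiction (after⇒before (overdue⁻ o*)) (¬overdue⁻ o)

      -- The triggering request is the witness: its deadline is now, so the window for `opt` is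
      -- empty. Hence no timely node is served for free as part of the initial path.
      S₀-overdue : ∀ u → lookup S₀ u ≡ true → before u ≡ true
      S₀-overdue u u∈S₀ = overdue⁺ (List.lose (All.head (remaining sound))
        (proj₂ (∈-path⁻ root (node ρ) (lookup⇒∈ u∈S₀)) , ρ-pending , ¬relieved-instantly))

      module _ (v : Node) (S : Subset size) (q : Prices) (v∈S : v ∈ S) (ok : Valid S q)
               (⊆S* : service (fall pending v S q) ⊆ S*) where
        private
          r = fall pending v S q
          spec = fall-spec pending v S q (pendingAt-sorted σ ρ) ok
          old′ = outlay S q
          new′ = outlay (service r) (newPrices r)

        -- Let `δ` be the request that keeps `v` overdue. It is still unsatisfied, so the fall of
        -- `v` ran out of budget, and it paid only for paths to requests `γ` due no later than `δ`.
        -- Had `opt` served a node `u` of such a path before the deadline of `γ`, that service would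
        -- contain the ancestor `v` and relieve it before the deadline of `δ`.
        stuck-fall : after v ≡ true →
          sum new′ ≡ sum old′ + cost v × (∀ u → old′ u ≡ new′ u ⊎ before u ≡ true)
        stuck-fall o* with List.find (overdue⁻ o*)
        ... | δ , δ∈ , v≼δ , (arrived , unsat) , ¬relieved = proj₁ spent , touched
          where
          δ∉S* : node δ ∉ S*
          δ∉S* δ∈S* = unsat (here (δ∈S* , arrived , live sound δ∈ (unsat ∘ there)))
          spent = exhausted spec
            (List.∈-filter⁺ (λ γ → v ≼? node γ)
              (List.∈-filter⁺ (pending? σ t) δ∈ (arrived , unsat ∘ there)) v≼δ)
            (δ∉S* ∘ ⊆S*)
          touched : ∀ u → old′ u ≡ new′ u ⊎ before u ≡ true
          touched u with proj₂ spent u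
          ... | inj₁ same = inj₁ same
          ... | inj₂ h with List.find h
          ...   | γ , γ∈ , v≼u , u≼γ , γ≤δ
                with List.∈-filter⁻ (pending? σ t) (proj₁ (List.∈-filter⁻ (λ γ → v ≼? node γ) {xs = pending} γ∈))
          ...     | γ∈ρs , γ-pending = inj₂ (overdue⁺ (List.lose γ∈ρs
                    (u≼γ , γ-pending , λ relieved → ¬relieved (relieved-≼ v≼u γ≤δ relieved))))

        private
          lower : ∀ {u} → upper v ≡ false → v ≼ u × u ∉ S → upper⁺ u ≡ false
          lower {u} v-low (v≼u , u∉S) with trueOrFalse (upper⁺ u)
          ... | inj₂ u-low = u-low
          ... | inj₁ u-up
            with () ← trans (sym v-low) (upper-step v≼u (λ { refl → u∉S v∈S }) u-up)

        -- A stuck node pays only for overdue nodes, and a node outside `upper` pays only for nodes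
        -- outside `upper⁺`; neither touches `timelyUpper`. In the remaining case the budget bounds
        -- the growth.
        up-fall : sumOn timelyUpper new′ ≤ sumOn timelyUpper old′ + (upper v ∧ not (after v)) · cost v
        up-fall with trueOrFalse (after v) | trueOrFalse (upper v)
        ... | inj₁ o* | _ = ≤-trans (≤-reflexive (sumOn-cong timelyUpper same)) (x≤x+y _ (·-nonneg (upper v ∧ not (after v)) (cost-nonneg v)))
          where
          same : ∀ u → timelyUpper u ≡ true → new′ u ≡ old′ u
          same u w with proj₂ (stuck-fall o*) u
          ... | inj₁ eq = sym eq
          ... | inj₂ o  with () ← trans (sym w) (trans (cong (λ x → upper⁺ u ∧ not x) o) (∧-zeroʳ (upper⁺ u)))
        ... | inj₂ o* | inj₁ l rewrite o* | l = ≤-shift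
          (solve 5 (λ x y x′ y′ c → x′ :+ ((x :+ y′) :+ (y :+ c)) := (x :+ c) :+ ((x′ :+ y) :+ y′)) refl
            (sumOn timelyUpper old′) (sum old′) (sumOn timelyUpper new′) (sum new′) (cost v))
          (+-mono-≤ (sumOn-gap-≤ timelyUpper {old′} {new′} (rising spec)) (within spec))
        ... | inj₂ o* | inj₂ l = ≤-trans (≤-reflexive (sumOn-cong timelyUpper same)) (x≤x+y _ (·-nonneg (upper v ∧ not (after v)) (cost-nonneg v)))
          where
          same : ∀ u → timelyUpper u ≡ true → new′ u ≡ old′ u
          same u w with below spec u
          ... | inj₁ eq = sym eq
          ... | inj₂ h  with () ← trans (sym w) (cong (_∧ not (before u)) (lower l h))

        -- A stuck node outside `upper` spends its entire budget, on nodes that are overdue and,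
        -- being proper descendants, outside `upper⁺`. In the other cases the charge is zero and
        -- outlays never fall.
        down-fall : sumOn overdueLower old′ + (not (upper v) ∧ after v) · cost v ≤ sumOn overdueLower new′
        down-fall with trueOrFalse (after v) | trueOrFalse (upper v)
        ... | inj₁ o* | inj₂ l rewrite o* | l = ≤-reflexive (+-cancelʳ-≡ (sum old′) (begin
          (sumOn overdueLower old′ + cost v) + sum old′  ≡⟨ solve 3 (λ x c y → (x :+ c) :+ y := x :+ (y :+ c)) refl (sumOn overdueLower old′) (cost v) (sum old′) ⟩
          sumOn overdueLower old′ + (sum old′ + cost v)  ≡⟨ cong (sumOn overdueLower old′ +_) (proj₁ (stuck-fall o*)) ⟨
          sumOn overdueLower old′ + sum new′             ≡⟨ sumOn-gap-≡ overdueLower {old′} {new′} same ⟨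
          sumOn overdueLower new′ + sum old′             ∎))
          where
          open ≡-Reasoning
          same : ∀ u → overdueLower u ≡ false → old′ u ≡ new′ u
          same u w with proj₂ (stuck-fall o*) u | below spec u
          ... | inj₁ eq | _       = eq
          ... | _       | inj₁ eq = eq
          ... | inj₂ o  | inj₂ h with () ← trans (sym w) (cong₂ (λ x y → not x ∧ y) (lower l h) o)
        ... | inj₁ o* | inj₁ l rewrite l = ≤-trans (≤-reflexive (R.+-identityʳ _))
          (sumOn-mono-≤ overdueLower λ u _ → rising spec u)
        ... | inj₂ o* | _ rewrite o* | ∧-zeroʳ (not (upper v)) = ≤-trans (≤-reflexive (R.+-identityʳ _))
          (sumOn-mono-≤ overdueLower λ u _ → rising spec u)

      up-serve : sumOn timelyUpper (outlay S* p*) ≤ sumOn timelyUpper (outlay S₀ p₀) + total (λ v → (upper v ∧ not (after v)) · cost v) S*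
      up-serve = serve-≤ timelyUpper (λ v → (upper v ∧ not (after v)) · cost v) up-fall

      down-serve : sumOn overdueLower (outlay S₀ p₀) + total (λ v → (not (upper v) ∧ after v) · cost v) S* ≤ sumOn overdueLower (outlay S* p*)
      down-serve = serve-≥ overdueLower (λ v → (not (upper v) ∧ after v) · cost v) down-fall

-- Invariants of a whole run and the bound per layer.

module CompetitiveRatio {a ℓ} (F : OrderedField a ℓ) (T : MLAPD.WeightedTree F)
                        (order : MLAPD.OnTree.EnqueueOrder F T) where
  open OrderedField F
  open FieldProperties F
  open MLAPD F
  open WeightedTree T
  open TreeProperties tree
  open OnTree T
  open FallProperties F T
  open ServeProperties F T order
  open LedgerProperties F T order
  open Waterfall order

  module Layer
    (ρs : List Request) (ρs-sorted : AllPairs _deadline≤_ ρs)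
    (opt : Schedule) (opt-subtrees : All (λ s → IsRootedSubtree (nodes s)) opt)
    (opt-serves : ∀ {γ} → γ List.∈ ρs → Any (Satisfies γ) opt)
    (upper upper⁺ : Node → Bool)
    (upper-step : ∀ {v u} → v ≼ u → v ≢ u → upper⁺ u ≡ true → upper v ≡ true)
    where
    open Soundness ρs ρs-sorted
    open Ledger ρs ρs-sorted opt opt-subtrees opt-serves upper upper⁺ upper-step

    low low⁺ : Node → Bool
    low  u = not (upper u)
    low⁺ u = not (upper⁺ u)

    -- timelyCost, stuckCost and settledCost split what the schedule has spent on
    -- each node by the kind of the node at the service, and `marked` is the set of
    -- nodes that were overdue after the last service.
    record Balanced (st : Prices × Schedule) (rest : List Request) : Set (a Level.⊔ ℓ) where
      p = proj₁ st
      σ = proj₂ st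
      field
        marked : Node → Bool
        timelyCost stuckCost settledCost : Node → Carrier
        split  : ∀ u → load σ u ≡ (timelyCost u + stuckCost u) + settledCost u
        -- Discounts on unmarked nodes are spent already but show up as timely cost only later, so
        -- they are counted in advance. In `down`, discounts on marked nodes are likewise spending
        -- of stuck nodes that is not yet visible as cost.
        up     : sumOn upper⁺ timelyCost + sumOn (λ u → upper⁺ u ∧ not (marked u)) (paid p)
               ≤ sumOn upper (λ u → timelyCost u + settledCost u)
        down   : sumOn low stuckCost
               ≤ sumOn low⁺ (λ u → stuckCost u + settledCost u) + sumOn (λ u → low⁺ u ∧ marked u) (paid p)
        -- One witness serves for all deadlines still to be visited: this is how a marked node is
        -- known to stay overdue until it is served.
        stale  : ∀ {u} → marked u ≡ true → ∃ λ γ → γ List.∈ ρs × u ≼ node γ × ¬ Any (Satisfies γ) σ ×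
                 (∀ {ρ} → ρ List.∈ rest → arrival γ ≤ deadline ρ × ¬ Relieved u (deadline ρ) (deadline γ))
        -- The time `τ` is that of the latest settling of `u`. The last clause records that `u` was
        -- not overdue just after it, which forces a further service of `u` by `opt` before `u` can
        -- settle again on account of an old request.
        repaid : ∀ u → settledCost u ≡ 0# ⊎ ∃ λ τ → (∀ {ρ} → ρ List.∈ rest → τ ≤ deadline ρ) ×
                 settledCost u ≤ loadBy τ opt u ×
                 (∀ {γ} → γ List.∈ ρs → u ≼ node γ → arrival γ ≤ τ → ¬ Any (Satisfies γ) σ → Relieved u τ (deadline γ))
    open Balanced public

    balanced-init : Balanced (cost , []) ρs
    balanced-init = record
      { marked = λ _ → false
      ; timelyCost = λ _ → 0# ; stuckCost = λ _ → 0# ; settledCost = λ _ → 0#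
      ; split = λ _ → solve 0 (con 0 := (con 0 :+ con 0) :+ con 0) refl
      ; up = ≤-reflexive (trans
          (cong₂ _+_ (sumOn-zero upper⁺ (λ _ → 0#) λ _ → refl) (sumOn-zero (λ u → upper⁺ u ∧ true) (paid cost) λ u → R.-‿inverseʳ (cost u)))
          (trans (R.+-identityˡ 0#) (sym (sumOn-zero upper (λ _ → 0# + 0#) λ _ → R.+-identityˡ 0#))))
      ; down = ≤-reflexive (trans (sumOn-zero low (λ _ → 0#) λ _ → refl) (sym (trans
          (cong₂ _+_ (sumOn-zero low⁺ (λ _ → 0# + 0#) λ _ → R.+-identityˡ 0#)
                     (sumOn-zero (λ u → low⁺ u ∧ false) (paid cost) λ u → R.-‿inverseʳ (cost u)))
          (R.+-identityˡ 0#))))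
      ; stale = λ ()
      ; repaid = λ _ → inj₁ refl
      }

    opt-serves-between : ∀ {γ u} → γ List.∈ ρs → u ≼ node γ →
      Any (λ s → u ∈ nodes s × arrival γ ≤ time s × time s ≤ deadline γ) opt
    opt-serves-between γ∈ u≼γ with List.find (opt-serves γ∈)
    ... | s , s∈ , γ∈s , sat = List.lose s∈ (closed-≼ (All.lookup opt-subtrees s∈) u≼γ γ∈s , sat)

    unrelieved⇒by-now : ∀ {u t d s} → ¬ Relieved u t d → s List.∈ opt → u ∈ nodes s → time s ≤ d → time s ≤ t
    unrelieved⇒by-now {t = t} {s = s} ¬relieved s∈ u∈s s≤d =
      decidable-stable (time s ≤? t) λ s≰t → ¬relieved (List.lose s∈ (u∈s , s≰t , s≤d))

    module Served {p₁ σ₁ ρ rest} (sound : Sound (p₁ , σ₁) (ρ ∷ rest)) (bal : Balanced (p₁ , σ₁) (ρ ∷ rest))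
                  (ρ-pending : Pending σ₁ (deadline ρ) ρ) where
      open AtDeadline sound ρ-pending

      n b c dn db dc : Node → Carrier
      n = timelyCost bal
      b = stuckCost bal
      c = settledCost bal
      dn u = (lookup S* u ∧ not (before u)) · cost u
      db u = (lookup S* u ∧ after u) · cost u
      dc u = (lookup S* u ∧ (before u ∧ not (after u))) · cost u

      t≤rest : ∀ {ε} → ε List.∈ rest → t ≤ deadline ε
      t≤rest ε∈ = All.lookup (AllPairs.head (ordered sound)) ε∈

      marked⇒before : ∀ {u} → marked bal u ≡ true → before u ≡ true
      marked⇒before m with stale bal m
      ... | γ , γ∈ , u≼γ , unsat , h = let arrived , ¬relieved = h (here refl) in
        overdue⁺ (List.lose γ∈ (u≼γ , (arrived , unsat) , ¬relieved))

      split′ : ∀ u → load σ* u ≡ ((n u + dn u) + (b u + db u)) + (c u + dc u)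
      split′ u = trans (cong₂ _+_ (kind-cost (cost u) (kind u)) (split bal u))
        (solve 6 (λ x y z x′ y′ z′ → ((x′ :+ y′) :+ z′) :+ ((x :+ y) :+ z) := ((x :+ x′) :+ (y :+ y′)) :+ (z :+ z′))
          refl (n u) (b u) (c u) (dn u) (db u) (dc u))

      up-after : sumOn upper⁺ dn + sumOn (λ u → upper⁺ u ∧ not (after u)) (paid p*)
               ≤ sumOn timelyUpper (outlay S* p*)
      up-after = subst (_≤ sumOn timelyUpper (outlay S* p*))
        (∑-distrib-+ (λ u → upper⁺ u · dn u) (λ u → (upper⁺ u ∧ not (after u)) · paid p* u))
        (sum-mono-≤ λ u → kind-up (cost u) (upper⁺ u) (paid p* u) (kind u) (paid-full valid* u))

      -- A node that is timely now was unmarked and lies outside the initial path, so its outlay at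
      -- the start is exactly the discount carried over. Discounts on nodes that have become overdue
      -- meanwhile are dropped.
      up-before : sumOn timelyUpper (outlay S₀ p₀)
                ≤ sumOn (λ u → upper⁺ u ∧ not (marked bal u)) (paid p₁)
      up-before = sum-mono-≤ pointwise
        where
        pointwise : ∀ u → (upper⁺ u ∧ not (before u)) · outlay S₀ p₀ u ≤ (upper⁺ u ∧ not (marked bal u)) · paid p₁ u
        pointwise u with trueOrFalse (before u)
        ... | inj₁ o rewrite o | ∧-zeroʳ (upper⁺ u) =
          ·-nonneg (upper⁺ u ∧ not (marked bal u)) (paid-nonneg (pricesOk sound) u)
        ... | inj₂ o with trueOrFalse (marked bal u) | trueOrFalse (lookup S₀ u)
        ...   | inj₁ m | _      with () ← trans (sym o) (marked⇒before m)
        ...   | inj₂ m | inj₁ s with () ← trans (sym o) (S₀-overdue u s)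
        ...   | inj₂ m | inj₂ s rewrite o | m | s =
          ≤-reflexive (cong ((upper⁺ u ∧ true) ·_) (R.+-identityˡ (paid p₁ u)))

      up-charge : total (λ v → (upper v ∧ not (after v)) · cost v) S* ≤ sumOn upper (λ u → dn u + dc u)
      up-charge = sum-mono-≤ λ u → kind-up-charge (cost u) (upper u) (kind u)

      up′ : sumOn upper⁺ (λ u → n u + dn u) + sumOn (λ u → upper⁺ u ∧ not (after u)) (paid p*)
          ≤ sumOn upper (λ u → (n u + dn u) + (c u + dc u))
      up′ = subst₂ _≤_ (cong (_+ sumOn (λ u → upper⁺ u ∧ not (after u)) (paid p*)) (sym (sumOn-distrib-+ upper⁺ n dn)))
        (trans (sym (sumOn-distrib-+ upper (λ u → n u + c u) (λ u → dn u + dc u)))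
          (sumOn-cong upper λ u _ → +-interchange (n u) (c u) (dn u) (dc u)))
        (≤-shift
          (solve 9 (λ n dn m* w* w₀ m f r dr →
              ((n :+ dn) :+ m*) :+ (((w* :+ (w₀ :+ f)) :+ (m :+ dr)) :+ r)
              := (r :+ dr) :+ ((((dn :+ m*) :+ w*) :+ (w₀ :+ f)) :+ (n :+ m)))
            refl (sumOn upper⁺ n) (sumOn upper⁺ dn) (sumOn (λ u → upper⁺ u ∧ not (after u)) (paid p*))
            (sumOn timelyUpper (outlay S* p*))
            (sumOn timelyUpper (outlay S₀ p₀))
            (sumOn (λ u → upper⁺ u ∧ not (marked bal u)) (paid p₁))
            (total (λ v → (upper v ∧ not (after v)) · cost v) S*)
            (sumOn upper (λ u → n u + c u)) (sumOn upper (λ u → dn u + dc u)))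
          (+-mono-≤ (+-mono-≤ (+-mono-≤ up-after up-serve) (+-mono-≤ up-before up-charge)) (up bal)))

      -- Marked nodes are still overdue. On the initial path the reset erases a discount, but the
      -- full cost that enters the outlay is at least as large.
      down-before : sumOn (λ u → low⁺ u ∧ marked bal u) (paid p₁) ≤ sumOn overdueLower (outlay S₀ p₀)
      down-before = sum-mono-≤ pointwise
        where
        paid≤outlay : ∀ u → paid p₁ u ≤ outlay S₀ p₀ u
        paid≤outlay u with lookup S₀ u
        ... | false = ≤-reflexive (sym (R.+-identityˡ (paid p₁ u)))
        ... | true  = ≤-shift {y = p₁ u} {cost u + (cost u - cost u)}
          (trans ([x-y]+y≡x (cost u) (p₁ u)) (sym (trans (R.+-identityʳ _)
            (trans (cong (cost u +_) (R.-‿inverseʳ (cost u))) (R.+-identityʳ (cost u))))))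
          (nonneg (pricesOk sound) u)
        outlay-nonneg : ∀ u → 0# ≤ outlay S₀ p₀ u
        outlay-nonneg u = ≤-trans (paid-nonneg (pricesOk sound) u) (paid≤outlay u)
        pointwise : ∀ u → (low⁺ u ∧ marked bal u) · paid p₁ u ≤ (low⁺ u ∧ before u) · outlay S₀ p₀ u
        pointwise u with low⁺ u | trueOrFalse (marked bal u)
        ... | false | _      = ≤-refl
        ... | true  | inj₁ m rewrite m | marked⇒before m = paid≤outlay u
        ... | true  | inj₂ m rewrite m = ·-nonneg (before u) (outlay-nonneg u)

      down-charge : sumOn low db ≤ total (λ v → (low v ∧ after v) · cost v) S*
      down-charge = sum-mono-≤ λ u → kind-down-charge (cost u) (low u) (lookup S* u) (after u)

      down-after : sumOn overdueLower (outlay S* p*)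
                 ≤ sumOn low⁺ (λ u → db u + dc u) + sumOn (λ u → low⁺ u ∧ after u) (paid p*)
      down-after = subst (sumOn overdueLower (outlay S* p*) ≤_)
        (∑-distrib-+ (λ u → low⁺ u · (db u + dc u)) (λ u → (low⁺ u ∧ after u) · paid p* u))
        (sum-mono-≤ λ u → kind-down (cost u) (low⁺ u) (paid p* u) (kind u) (paid-full valid* u))

      down′ : sumOn low (λ u → b u + db u)
            ≤ sumOn low⁺ (λ u → (b u + db u) + (c u + dc u)) + sumOn (λ u → low⁺ u ∧ after u) (paid p*)
      down′ = subst₂ _≤_ (sym (sumOn-distrib-+ low b db))
        (cong (_+ sumOn (λ u → low⁺ u ∧ after u) (paid p*)) (trans (sym (sumOn-distrib-+ low⁺ (λ u → b u + c u) (λ u → db u + dc u)))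
          (sumOn-cong low⁺ λ u _ → +-interchange (b u) (c u) (db u) (dc u))))
        (≤-shift
          (solve 9 (λ b db m* v* v₀ m g r dr →
              (b :+ db) :+ ((((v₀ :+ g) :+ v*) :+ (dr :+ m*)) :+ (r :+ m))
              := ((r :+ dr) :+ m*) :+ (((m :+ db) :+ (v₀ :+ g)) :+ v* :+ b))
            refl (sumOn low b) (sumOn low db) (sumOn (λ u → low⁺ u ∧ after u) (paid p*))
            (sumOn overdueLower (outlay S* p*))
            (sumOn overdueLower (outlay S₀ p₀))
            (sumOn (λ u → low⁺ u ∧ marked bal u) (paid p₁))
            (total (λ v → (low v ∧ after v) · cost v) S*)
            (sumOn low⁺ (λ u → b u + c u)) (sumOn low⁺ (λ u → db u + dc u)))
          (+-mono-≤ (+-mono-≤ (+-mono-≤ (+-mono-≤ down-before down-charge) down-serve) down-after) (down bal)))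

      stale′ : ∀ {u} → after u ≡ true → ∃ λ γ → γ List.∈ ρs × u ≼ node γ × ¬ Any (Satisfies γ) σ* ×
        (∀ {ε} → ε List.∈ rest → arrival γ ≤ deadline ε × ¬ Relieved u (deadline ε) (deadline γ))
      stale′ o* with List.find (overdue⁻ o*)
      ... | γ , γ∈ , u≼γ , (arrived , unsat) , ¬relieved = γ , γ∈ , u≼γ , unsat ,
        λ ε∈ → ≤-trans arrived (t≤rest ε∈) , ¬relieved ∘ relieved-mono (t≤rest ε∈)

      Repaid : Node → Carrier → Set (a Level.⊔ ℓ)
      Repaid u x = x ≡ 0# ⊎ ∃ λ τ → (∀ {ε} → ε List.∈ rest → τ ≤ deadline ε) × x ≤ loadBy τ opt u ×
        (∀ {γ} → γ List.∈ ρs → u ≼ node γ → arrival γ ≤ τ → ¬ Any (Satisfies γ) σ* → Relieved u τ (deadline γ))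

      -- If opt served the overdue request before the previous settling of u, at τ,
      -- then that request was pending at τ, so opt served u again after τ.
      settle : ∀ {u} → Overdue σ₁ t u → c u + cost u ≤ loadBy t opt u
      settle {u} o with List.find o
      ... | γ , γ∈ , u≼γ , (arrived , unsat) , ¬relieved
        with List.find (opt-serves-between γ∈ u≼γ) | repaid bal u
      ... | s , s∈ , u∈s , a≤s , s≤d | inj₁ c≡0 = subst (λ x → x + cost u ≤ loadBy t opt u) (sym c≡0)
        (≤-trans (≤-reflexive (R.+-identityˡ (cost u)))
          (loadBy-served opt u (List.lose s∈ (u∈s , unrelieved⇒by-now ¬relieved s∈ u∈s s≤d))))
      ... | s , s∈ , u∈s , a≤s , s≤d | inj₂ (τ , τ≤ , paid-off , relief) =
        ≤-trans (+-monoˡ-≤ (cost u) paid-off) (loadBy-advance (τ≤ (here refl)) opt u since-τ)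
        where
        since-τ : Relieved u τ t
        since-τ with time s ≤? τ
        ... | no  s≰τ = List.lose s∈ (u∈s , s≰τ , unrelieved⇒by-now ¬relieved s∈ u∈s s≤d)
        ... | yes s≤τ with List.find (relief γ∈ u≼γ (≤-trans a≤s s≤τ) unsat)
        ...   | s′ , s′∈ , u∈s′ , s′≰τ , s′≤d =
          List.lose s′∈ (u∈s′ , s′≰τ , unrelieved⇒by-now ¬relieved s′∈ u∈s′ s′≤d)

      repaid′ : ∀ u → Repaid u (c u + dc u)
      repaid′ u with kind-settled (kind u)
      ... | inj₁ (o , o* , settled′) = subst (λ w → Repaid u (c u + w · cost u)) (sym settled′)
        (inj₂ (t , t≤rest , settle (overdue⁻ o) , λ {γ} γ∈ u≼γ arrived unsat →
          decidable-stable (relieved? u t (deadline γ))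
            λ ¬relieved → ¬overdue⁻ o* (List.lose γ∈ (u≼γ , (arrived , unsat) , ¬relieved))))
      ... | inj₂ ¬settled = subst (λ w → Repaid u (c u + w · cost u)) (sym ¬settled)
        (subst (Repaid u) (sym (R.+-identityʳ (c u))) carried)
        where
        carried : Repaid u (c u)
        carried with repaid bal u
        ... | inj₁ c≡0 = inj₁ c≡0
        ... | inj₂ (τ , τ≤ , paid-off , relief) = inj₂ (τ , (λ ε∈ → τ≤ (there ε∈)) , paid-off ,
          λ γ∈ u≼γ arrived unsat → relief γ∈ u≼γ arrived (unsat ∘ there))

      balanced′ : Balanced (p* , σ*) rest
      balanced′ = record
        { marked = after
        ; timelyCost = λ u → n u + dn u ; stuckCost = λ u → b u + db u ; settledCost = λ u → c u + dc u
        ; split = split′ ; up = up′ ; down = down′ ; stale = stale′ ; repaid = repaid′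
        }

    balanced-step : ∀ {st ρ rest} → Sound st (ρ ∷ rest) → Balanced st (ρ ∷ rest) →
      Balanced (onDeadline ρs st ρ) rest
    balanced-step {p₁ , σ₁} {ρ} {rest} sound bal = if-does (λ st → Balanced st rest)
      (pending? σ₁ (deadline ρ) ρ) (Served.balanced′ sound bal) λ _ → record
        { marked = marked bal
        ; timelyCost = timelyCost bal ; stuckCost = stuckCost bal ; settledCost = settledCost bal
        ; split = split bal ; up = up bal ; down = down bal
        ; stale = λ m → let γ , γ∈ , u≼γ , unsat , h = stale bal m in γ , γ∈ , u≼γ , unsat , λ ε∈ → h (there ε∈)
        ; repaid = λ u → repaid-tail (repaid bal u)
        }
      where
      repaid-tail : ∀ {x} {A : Carrier → Set (a Level.⊔ ℓ)} →
        x ≡ 0# ⊎ ∃ (λ τ → (∀ {ε} → ε List.∈ ρ ∷ rest → τ ≤ deadline ε) × A τ) →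
        x ≡ 0# ⊎ ∃ (λ τ → (∀ {ε} → ε List.∈ rest → τ ≤ deadline ε) × A τ)
      repaid-tail (inj₁ x≡0)          = inj₁ x≡0
      repaid-tail (inj₂ (τ , τ≤ , h)) = inj₂ (τ , (λ ε∈ → τ≤ (there ε∈)) , h)

    -- By `up`, the timely cost of `upper⁺` is at most the timely plus the settled cost of `upper`.
    -- Taking complements in `down`, the stuck cost of `upper⁺` is at most the stuck cost of `upper`
    -- plus the settled cost of `low⁺`. The latter and the settled cost of `upper⁺` make up the
    -- whole settled cost, which `opt` covers.
    layer-cost : ∀ {st} → Sound st [] → Balanced st [] →
      sumOn upper⁺ (load (proj₂ st)) ≤ sumOn upper (load (proj₂ st)) + scheduleCost opt
    layer-cost {p₁ , σ₁} sound bal = subst₂ _≤_ (sym (load-split upper⁺)) (cong (_+ scheduleCost opt) (sym (load-split upper)))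
      (≤-shift
        (solve 12 (λ n⁺ b⁺ c⁺ n b c m bl bl⁺ cl⁺ o z →
            ((n⁺ :+ b⁺) :+ c⁺) :+ (((((n :+ c) :+ m) :+ ((bl⁺ :+ cl⁺) :+ z)) :+ (b :+ bl)) :+ o)
            := (((n :+ b) :+ c) :+ o) :+ (((((n⁺ :+ m) :+ z) :+ bl) :+ (b⁺ :+ bl⁺)) :+ (c⁺ :+ cl⁺)))
          refl (sumOn upper⁺ n) (sumOn upper⁺ b) (sumOn upper⁺ c) (sumOn upper n) (sumOn upper b) (sumOn upper c)
          (sumOn (λ u → upper⁺ u ∧ not (marked bal u)) (paid p₁)) (sumOn low b) (sumOn low⁺ b) (sumOn low⁺ c)
          (scheduleCost opt) 0#)
        (+-mono-≤ (+-mono-≤ (+-mono-≤ (+-mono-≤ up″ paid≥0) down″)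
          (≤-reflexive (trans (sumOn-complement upper⁺ b) (sym (sumOn-complement upper b)))))
          (≤-trans (≤-reflexive (sumOn-complement upper⁺ c)) settled≤opt)))
      where
      n = timelyCost bal
      b = stuckCost bal
      c = settledCost bal

      load-split : ∀ W → sumOn W (load σ₁) ≡ (sumOn W n + sumOn W b) + sumOn W c
      load-split W = trans (sumOn-cong W λ u _ → split bal u)
        (trans (sumOn-distrib-+ W (λ u → n u + b u) c) (cong (_+ sumOn W c) (sumOn-distrib-+ W n b)))

      paid≥0 : 0# ≤ sumOn (λ u → upper⁺ u ∧ not (marked bal u)) (paid p₁)
      paid≥0 = sumOn-nonneg _ (paid p₁) (paid-nonneg (pricesOk sound))

      up″ : sumOn upper⁺ n + sumOn (λ u → upper⁺ u ∧ not (marked bal u)) (paid p₁) ≤ sumOn upper n + sumOn upper c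
      up″ = subst (sumOn upper⁺ n + sumOn (λ u → upper⁺ u ∧ not (marked bal u)) (paid p₁) ≤_)
        (sumOn-distrib-+ upper n c) (up bal)

      -- With no deadline left every request is satisfied, so nothing is overdue and no spending of
      -- stuck nodes is still outstanding as a discount.
      unmarked : ∀ u → marked bal u ≡ false
      unmarked u with trueOrFalse (marked bal u)
      ... | inj₂ m = m
      ... | inj₁ m with stale bal m
      ...   | γ , γ∈ , _ , unsat , _ with covered sound γ∈
      ...     | inj₁ sat = contradiction sat unsat

      nothing-marked : sumOn (λ u → low⁺ u ∧ marked bal u) (paid p₁) ≡ 0#
      nothing-marked = sum-zero λ u →
        cong (_· paid p₁ u) (trans (cong (low⁺ u ∧_) (unmarked u)) (∧-zeroʳ (low⁺ u)))

      down″ : sumOn low b ≤ (sumOn low⁺ b + sumOn low⁺ c) + 0#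
      down″ = subst (sumOn low b ≤_) (cong₂ _+_ (sumOn-distrib-+ low⁺ b c) nothing-marked) (down bal)

      settled≤opt : sum c ≤ scheduleCost opt
      settled≤opt = ≤-trans (sum-mono-≤ pointwise) (≤-reflexive (sym (scheduleCost-load opt)))
        where
        pointwise : ∀ u → c u ≤ load opt u
        pointwise u with repaid bal u
        ... | inj₁ c≡0 = ≤-trans (≤-reflexive c≡0) (load-nonneg opt u)
        ... | inj₂ (τ , _ , c≤ , _) = ≤-trans c≤ (loadBy≤load τ opt u)

    waterfall-layer : let σ = proj₂ (foldl (onDeadline ρs) (cost , []) ρs) in
      sumOn upper⁺ (load σ) ≤ sumOn upper (load σ) + scheduleCost opt
    waterfall-layer = let sound , bal = run-invariant Balanced balanced-step ρs sound-init balanced-init in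
      layer-cost sound bal

  levelUpTo : ℕ → Node → Bool
  levelUpTo k u = does (level u ℕ.≤? k)

  module _ (R : RequestSet) (opt : Schedule) (opt-feasible : Feasible R opt) where

    waterfall-levels : ∀ k → sumOn (levelUpTo k) (load (waterfall R)) ≤ fromℕ k * scheduleCost opt
    -- Levels count nodes, so level zero is empty; each further layer adds one copy of the cost of
    -- `opt`.
    waterfall-levels zero = ≤-reflexive (trans
      (sum-zero λ u → cong (_· load (waterfall R) u) (dec-false (level u ℕ.≤? 0) (ℕ.<⇒≱ (level-positive u))))
      (sym (R.zeroˡ (scheduleCost opt))))
    waterfall-levels (suc k) = ≤-trans
      (Layer.waterfall-layer (sort (requests R)) (sorted (requests R)) opt (proj₁ opt-feasible)
        (λ γ∈ → All.lookup (proj₂ opt-feasible) (Perm.∈-resp-↭ (sort-↭ (requests R)) γ∈))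
        (levelUpTo k) (levelUpTo (suc k)) step)
      (≤-trans (+-monoˡ-≤ (scheduleCost opt) (waterfall-levels k)) (≤-reflexive
        (solve 2 (λ k o → k :* o :+ o := (con 1 :+ k) :* o) refl (fromℕ k) (scheduleCost opt))))
      where
      step : ∀ {v u} → v ≼ u → v ≢ u → levelUpTo (suc k) u ≡ true → levelUpTo k v ≡ true
      step {v} {u} v≼u v≢u u-upper = dec-true (level v ℕ.≤? k)
        (ℕ.≤-pred (ℕ.<-≤-trans (level-< v≼u v≢u) (does-true⁻ (level u ℕ.≤? suc k) u-upper)))

    waterfall-cost : scheduleCost (waterfall R) ≤ fromℕ depth * scheduleCost opt
    waterfall-cost = subst (_≤ fromℕ depth * scheduleCost opt)
      (trans (sum-cong-≗ λ u → cong (_· load (waterfall R) u) (dec-true (level u ℕ.≤? depth) (level≤depth u)))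
        (sym (scheduleCost-load (waterfall R))))
      (waterfall-levels depth)

mainTheorem6 : ∀ {a ℓ} (F : OrderedField a ℓ) →
    let open OrderedField F using (fromℕ)
        open MLAPD F in
    (T : WeightedTree) (D : ℕ) → WeightedTree.depth T ≡ D →
    let open OnTree T in
    (order : EnqueueOrder) →
    Competitive (fromℕ D) (Waterfall.waterfall order)
mainTheorem6 F T D refl order R =
  ServeProperties.feasible F T order R ,
  λ opt optimal → CompetitiveRatio.waterfall-cost F T order R opt (proj₁ optimal)
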